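{- For every nonnegative integer $r$, $$\sum_{n=1}^{\infty}\frac{1}{(n+1)(2n+3)(2n+2r+3)}\frac{\binom{2n}{n}}{\binom{2n+2r+2}{n+r+1}}=\frac{1}{2(2r+1)\binom{2r}{r}}-\frac{1}{3(2r+3)\binom{2r+2}{r+1}}-\frac{1}{2^{2r+1}}\left(\frac{1}{4(r+1)}+\frac{\binom{2r}{r}}{2\cdot 4^{r+1}}\left(\frac{\pi^2}{2}+\sum_{k=1}^r\frac{4^k}{k^2\binom{2k}{k}}\right)\right).$$ -}

module Defs where

open import Data.Integer.Base as ℤ using (+_; +[1+_])
import Data.Integer.Properties as ℤ
open import Data.Nat.Base as ℕ using (ℕ; zero; suc; NonZero)
open import Data.Nat.Combinatorics using (_C_; nCk≡n!/k![n-k]!; k![n∸k]!∣n!)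
open import Data.Nat.DivMod using (m≥n⇒m/n>0)
open import Data.Nat.Divisibility using (∣⇒≤)
import Data.Nat.Properties as ℕ
open import Data.Product.Base using (∃; _×_; _,_)
open import Data.Rational.Base hiding (NonZero)
open import Data.Rational.Properties
open import Data.Rational.Solver using (module +-*-Solver)
import Data.Rational.Unnormalised.Base as ℚᵘ
import Data.Rational.Unnormalised.Properties as ℚᵘ
open import Data.Sum.Base using (inj₁; inj₂)
open import Relation.Binary.PropositionalEquality using (_≡_; refl; sym; trans; cong; cong₂; subst; module ≡-Reasoning)

open +-*-Solver using (solve; _:+_; _:*_; _:-_; :-_; _:=_)

IsCauchy : (ℕ → ℚ) → Set
IsCauchy x = ∀ ε → 0ℚ < ε → ∃ λ N → ∀ m n → N ℕ.≤ m → N ℕ.≤ n → ∣ x m - x n ∣ < ε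

record ℝ : Set where
  constructor mkℝ
  field
    seq    : ℕ → ℚ
    cauchy : IsCauchy seq

open ℝ public

half+half : ∀ ε → ½ * ε + ½ * ε ≡ ε
half+half ε = trans (sym (*-distribʳ-+ ε ½ ½)) (*-identityˡ ε)

half>0 : ∀ {ε} → 0ℚ < ε → 0ℚ < ½ * ε
half>0 {ε} ε>0 = positive⁻¹ (½ * ε) {{pos*pos⇒pos ½ ε {{positive ε>0}}}}

∣p-q∣≡∣q-p∣ : ∀ p q → ∣ p - q ∣ ≡ ∣ q - p ∣
∣p-q∣≡∣q-p∣ p q = trans (sym (∣-p∣≡∣p∣ (p - q)))
  (cong ∣_∣ (solve 2 (λ p q → :- (p :- q) := q :- p) refl p q))

const-cauchy : ∀ q → IsCauchy (λ _ → q)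
const-cauchy q ε ε>0 = 0 , λ _ _ _ _ → subst (_< ε) (sym (cong ∣_∣ (+-inverseʳ q))) ε>0

neg-cauchy : ∀ {x} → IsCauchy x → IsCauchy (λ n → - x n)
neg-cauchy {x} cx ε ε>0 with cx ε ε>0
... | N , h = N , λ m n N≤m N≤n → subst (_< ε)
  (trans (sym (∣-p∣≡∣p∣ (x m - x n)))
         (cong ∣_∣ (neg-distrib-+ (x m) (- x n))))
  (h m n N≤m N≤n)

+-cauchy : ∀ {x y} → IsCauchy x → IsCauchy y → IsCauchy (λ n → x n + y n)
+-cauchy {x} {y} cx cy ε ε>0 with cx (½ * ε) (half>0 ε>0) | cy (½ * ε) (half>0 ε>0)
... | N , h | M , k = N ℕ.⊔ M , λ m n p≤m p≤n →
  begin-strict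
    ∣ (x m + y m) - (x n + y n) ∣
      ≡⟨ cong ∣_∣ (solve 4 (λ a b c d → (a :+ b) :- (c :+ d) := (a :- c) :+ (b :- d))
                     refl (x m) (y m) (x n) (y n)) ⟩
    ∣ (x m - x n) + (y m - y n) ∣      ≤⟨ ∣p+q∣≤∣p∣+∣q∣ (x m - x n) (y m - y n) ⟩
    ∣ x m - x n ∣ + ∣ y m - y n ∣      <⟨ +-mono-< (h m n (N≤ p≤m) (N≤ p≤n)) (k m n (M≤ p≤m) (M≤ p≤n)) ⟩
    ½ * ε + ½ * ε                      ≡⟨ half+half ε ⟩
    ε                                  ∎
  where
  open ≤-Reasoning
  N≤ : ∀ {l} → N ℕ.⊔ M ℕ.≤ l → N ℕ.≤ l
  N≤ = ℕ.m⊔n≤o⇒m≤o N M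
  M≤ : ∀ {l} → N ℕ.⊔ M ℕ.≤ l → M ℕ.≤ l
  M≤ = ℕ.m⊔n≤o⇒n≤o N M

∣p∣-∣q∣≤∣p-q∣ : ∀ p q → ∣ p ∣ - ∣ q ∣ ≤ ∣ p - q ∣
∣p∣-∣q∣≤∣p-q∣ p q = begin
  ∣ p ∣ - ∣ q ∣                  ≡⟨ cong (λ t → ∣ t ∣ - ∣ q ∣) (solve 2 (λ p q → p := (p :- q) :+ q) refl p q) ⟩
  ∣ (p - q) + q ∣ - ∣ q ∣        ≤⟨ +-monoˡ-≤ (- ∣ q ∣) (∣p+q∣≤∣p∣+∣q∣ (p - q) q) ⟩
  (∣ p - q ∣ + ∣ q ∣) - ∣ q ∣    ≡⟨ solve 2 (λ a b → (a :+ b) :- b := a) refl (∣ p - q ∣) (∣ q ∣) ⟩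
  ∣ p - q ∣                      ∎
  where open ≤-Reasoning

∣∣p∣-∣q∣∣≤∣p-q∣ : ∀ p q → ∣ ∣ p ∣ - ∣ q ∣ ∣ ≤ ∣ p - q ∣
∣∣p∣-∣q∣∣≤∣p-q∣ p q with ∣p∣≡p∨∣p∣≡-p (∣ p ∣ - ∣ q ∣)
... | inj₁ eq = ≤-trans (≤-reflexive eq) (∣p∣-∣q∣≤∣p-q∣ p q)
... | inj₂ eq = begin
  ∣ ∣ p ∣ - ∣ q ∣ ∣    ≡⟨ eq ⟩
  - (∣ p ∣ - ∣ q ∣)    ≡⟨ solve 2 (λ a b → :- (a :- b) := b :- a) refl (∣ p ∣) (∣ q ∣) ⟩
  ∣ q ∣ - ∣ p ∣        ≤⟨ ∣p∣-∣q∣≤∣p-q∣ q p ⟩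
  ∣ q - p ∣            ≡⟨ ∣p-q∣≡∣q-p∣ q p ⟩
  ∣ p - q ∣            ∎
  where open ≤-Reasoning

∣∣-cauchy : ∀ {x} → IsCauchy x → IsCauchy (λ n → ∣ x n ∣)
∣∣-cauchy {x} cx ε ε>0 with cx ε ε>0
... | N , h = N , λ m n N≤m N≤n → ≤-<-trans (∣∣p∣-∣q∣∣≤∣p-q∣ (x m) (x n)) (h m n N≤m N≤n)

eventually-bounded : ∀ {x} → IsCauchy x →
  ∃ λ B → ∃ λ N → ∀ n → N ℕ.≤ n → ∣ x n ∣ < B
eventually-bounded {x} cx with cx 1ℚ (positive⁻¹ 1ℚ)
... | N , h = ∣ x N ∣ + 1ℚ , N , λ n N≤n → begin-strict
  ∣ x n ∣                      ≡⟨ cong ∣_∣ (solve 2 (λ p q → p := q :+ (p :- q)) refl (x n) (x N)) ⟩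
  ∣ x N + (x n - x N) ∣        ≤⟨ ∣p+q∣≤∣p∣+∣q∣ (x N) (x n - x N) ⟩
  ∣ x N ∣ + ∣ x n - x N ∣      <⟨ +-monoʳ-< (∣ x N ∣) (h n N N≤n ℕ.≤-refl) ⟩
  ∣ x N ∣ + 1ℚ                 ∎
  where open ≤-Reasoning

*-mono-≤-nonNeg : ∀ {p q r s} → 0ℚ ≤ r → 0ℚ ≤ q → p ≤ q → r ≤ s → p * r ≤ q * s
*-mono-≤-nonNeg {p} {q} {r} {s} 0≤r 0≤q p≤q r≤s = ≤-trans
  (*-monoʳ-≤-nonNeg r {{nonNegative 0≤r}} p≤q)
  (*-monoˡ-≤-nonNeg q {{nonNegative 0≤q}} r≤s)

product-diff : ∀ a b c d → a * b - c * d ≡ a * (b - d) + d * (a - c)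
product-diff = solve 4 (λ a b c d → a :* b :- c :* d := a :* (b :- d) :+ d :* (a :- c)) refl

product-bound : ∀ A B δ a b c d → 0ℚ ≤ A → 0ℚ ≤ B →
  ∣ a ∣ ≤ A → ∣ d ∣ ≤ B → ∣ b - d ∣ ≤ δ → ∣ a - c ∣ ≤ δ →
  ∣ a * b - c * d ∣ ≤ (A + B) * δ
product-bound A B δ a b c d 0≤A 0≤B a≤A d≤B b-d≤δ a-c≤δ = begin
  ∣ a * b - c * d ∣                            ≡⟨ cong ∣_∣ (product-diff a b c d) ⟩
  ∣ a * (b - d) + d * (a - c) ∣                ≤⟨ ∣p+q∣≤∣p∣+∣q∣ (a * (b - d)) (d * (a - c)) ⟩
  ∣ a * (b - d) ∣ + ∣ d * (a - c) ∣            ≡⟨ cong₂ _+_ (∣p*q∣≡∣p∣*∣q∣ a (b - d)) (∣p*q∣≡∣p∣*∣q∣ d (a - c)) ⟩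
  ∣ a ∣ * ∣ b - d ∣ + ∣ d ∣ * ∣ a - c ∣        ≤⟨ +-mono-≤ (*-mono-≤-nonNeg (0≤∣p∣ (b - d)) 0≤A a≤A b-d≤δ)
                                                           (*-mono-≤-nonNeg (0≤∣p∣ (a - c)) 0≤B d≤B a-c≤δ) ⟩
  A * δ + B * δ                                ≡⟨ *-distribʳ-+ δ A B ⟨
  (A + B) * δ                                  ∎
  where open ≤-Reasoning

half<self : ∀ {ε} → 0ℚ < ε → ½ * ε < ε
half<self {ε} ε>0 = begin-strict
  ½ * ε            ≡⟨ +-identityʳ (½ * ε) ⟨
  ½ * ε + 0ℚ       <⟨ +-monoʳ-< (½ * ε) (half>0 ε>0) ⟩
  ½ * ε + ½ * ε    ≡⟨ half+half ε ⟩
  ε                ∎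
  where open ≤-Reasoning

shrink : ∀ S ε → 0ℚ < S → 0ℚ < ε → ∃ λ δ → 0ℚ < δ × S * δ ≡ ε
shrink S ε S>0 ε>0 =
  1/ S * ε ,
  positive⁻¹ (1/ S * ε) {{pos*pos⇒pos (1/ S) {{1/pos⇒pos S}} ε {{positive ε>0}}}} ,
  trans (sym (*-assoc S (1/ S) ε)) (trans (cong (_* ε) (*-inverseʳ S)) (*-identityˡ ε))
  where instance
    S-pos = positive S>0
    S-nonZero = pos⇒nonZero S

*-cauchy : ∀ {x y} → IsCauchy x → IsCauchy y → IsCauchy (λ n → x n * y n)
*-cauchy {x} {y} cx cy ε ε>0 =
  let A , Nx , bx  = eventually-bounded cx
      B , Ny , by  = eventually-bounded cy
      A>0          = ≤-<-trans (0≤∣p∣ (x Nx)) (bx Nx ℕ.≤-refl)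
      B>0          = ≤-<-trans (0≤∣p∣ (y Ny)) (by Ny ℕ.≤-refl)
      δ , δ>0 , eq = shrink (A + B) (½ * ε) (+-mono-< A>0 B>0) (half>0 ε>0)
      N , h        = cx δ δ>0
      M , k        = cy δ δ>0
  in (Nx ℕ.⊔ Ny) ℕ.⊔ (N ℕ.⊔ M) , λ m n ≤m ≤n →
    ≤-<-trans
      (product-bound A B δ (x m) (y m) (x n) (y n) (<⇒≤ A>0) (<⇒≤ B>0)
        (<⇒≤ (bx m (ℕ.m⊔n≤o⇒m≤o Nx Ny (ℕ.m⊔n≤o⇒m≤o (Nx ℕ.⊔ Ny) (N ℕ.⊔ M) ≤m))))
        (<⇒≤ (by n (ℕ.m⊔n≤o⇒n≤o Nx Ny (ℕ.m⊔n≤o⇒m≤o (Nx ℕ.⊔ Ny) (N ℕ.⊔ M) ≤n))))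
        (<⇒≤ (k m n (ℕ.m⊔n≤o⇒n≤o N M (ℕ.m⊔n≤o⇒n≤o (Nx ℕ.⊔ Ny) (N ℕ.⊔ M) ≤m))
                    (ℕ.m⊔n≤o⇒n≤o N M (ℕ.m⊔n≤o⇒n≤o (Nx ℕ.⊔ Ny) (N ℕ.⊔ M) ≤n))))
        (<⇒≤ (h m n (ℕ.m⊔n≤o⇒m≤o N M (ℕ.m⊔n≤o⇒n≤o (Nx ℕ.⊔ Ny) (N ℕ.⊔ M) ≤m))
                    (ℕ.m⊔n≤o⇒m≤o N M (ℕ.m⊔n≤o⇒n≤o (Nx ℕ.⊔ Ny) (N ℕ.⊔ M) ≤n)))))
      (subst (_< ε) (sym eq) (half<self ε>0))

fromℚ : ℚ → ℝ
fromℚ q = mkℝ (λ _ → q) (const-cauchy q)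

infix  4 _≤ᴿ_
infixl 6 _+ᴿ_ _-ᴿ_
infixl 7 _*ᴿ_
infix  8 -ᴿ_

_+ᴿ_ : ℝ → ℝ → ℝ
x +ᴿ y = mkℝ (λ n → seq x n + seq y n) (+-cauchy {seq x} {seq y} (cauchy x) (cauchy y))

-ᴿ_ : ℝ → ℝ
-ᴿ x = mkℝ (λ n → - seq x n) (neg-cauchy {seq x} (cauchy x))

_-ᴿ_ : ℝ → ℝ → ℝ
x -ᴿ y = x +ᴿ (-ᴿ y)

_*ᴿ_ : ℝ → ℝ → ℝ
x *ᴿ y = mkℝ (λ n → seq x n * seq y n) (*-cauchy {seq x} {seq y} (cauchy x) (cauchy y))

∣_∣ᴿ : ℝ → ℝ
∣ x ∣ᴿ = mkℝ (λ n → ∣ seq x n ∣) (∣∣-cauchy {seq x} (cauchy x))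

-- The slack ε makes this respect the identification of Cauchy sequences
-- whose difference tends to 0.
_≤ᴿ_ : ℝ → ℝ → Set
x ≤ᴿ y = ∀ ε → 0ℚ < ε → ∃ λ N → ∀ n → N ℕ.≤ n → seq x n ≤ seq y n + ε

sum₁ : ((k : ℕ) .{{_ : NonZero k}} → ℚ) → ℕ → ℚ
sum₁ f zero    = 0ℚ
sum₁ f (suc n) = sum₁ f n + f (suc n)

HasSum₁ : ((k : ℕ) .{{_ : NonZero k}} → ℚ) → ℝ → Set
HasSum₁ f x = ∀ ε → 0ℚ < ε →
  ∃ λ N → ∀ n → N ℕ.≤ n → ∣ fromℚ (sum₁ f n) -ᴿ x ∣ᴿ ≤ᴿ fromℚ ε

odd⁻¹ : ℕ → ℚ
odd⁻¹ k = + 1 / (1 ℕ.+ 2 ℕ.* k)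

sign : ℕ → ℚ
sign zero    = 1ℚ
sign (suc k) = - sign k

leibniz : ℕ → ℚ
leibniz zero    = 0ℚ
leibniz (suc n) = leibniz n + sign n * odd⁻¹ n

recip-antimono : ∀ m n .{{_ : NonZero m}} .{{_ : NonZero n}} → m ℕ.≤ n → + 1 / n ≤ + 1 / m
recip-antimono m@(suc _) n@(suc _) m≤n = toℚᵘ-cancel-≤ (begin
  toℚᵘ (+ 1 / n)    ≃⟨ toℚᵘ-fromℚᵘ (+ 1 ℚᵘ./ n) ⟩
  + 1 ℚᵘ./ n        ≤⟨ ℚᵘ.*≤* (ℤ.*-monoˡ-≤-nonNeg (+ 1) (ℤ.+≤+ m≤n)) ⟩
  + 1 ℚᵘ./ m        ≃⟨ toℚᵘ-fromℚᵘ (+ 1 ℚᵘ./ m) ⟨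
  toℚᵘ (+ 1 / m)    ∎)
  where open ℚᵘ.≤-Reasoning

recip-pos : ∀ n .{{_ : NonZero n}} → 0ℚ < + 1 / n
recip-pos n = positive⁻¹ (+ 1 / n) {{normalize-pos 1 n}}

archimedean : ∀ ε → 0ℚ < ε → ∃ λ d → + 1 / suc d ≤ ε
archimedean ε@(mkℚ +[1+ p ] d _) _ = d , toℚᵘ-cancel-≤ (begin
  toℚᵘ (+ 1 / suc d)   ≃⟨ toℚᵘ-fromℚᵘ (+ 1 ℚᵘ./ suc d) ⟩
  + 1 ℚᵘ./ suc d       ≤⟨ ℚᵘ.*≤* (ℤ.*-monoʳ-≤-nonNeg (+ suc d) {+ 1} {+ suc p} (ℤ.+≤+ (ℕ.s≤s ℕ.z≤n))) ⟩
  toℚᵘ ε               ∎)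
  where open ℚᵘ.≤-Reasoning
archimedean (mkℚ (+ zero) _ _) (*<* (ℤ.+<+ ()))
archimedean (mkℚ ℤ.-[1+ _ ] _ _) (*<* ())

odd⁻¹-antimono : ∀ {m n} → m ℕ.≤ n → odd⁻¹ n ≤ odd⁻¹ m
odd⁻¹-antimono {m} {n} m≤n = recip-antimono (1 ℕ.+ 2 ℕ.* m) (1 ℕ.+ 2 ℕ.* n) (ℕ.s≤s (ℕ.*-monoʳ-≤ 2 m≤n))

tail : ℕ → ℕ → ℚ
tail N zero    = 0ℚ
tail N (suc j) = odd⁻¹ N - tail (suc N) j

0≤tail : ∀ N j → 0ℚ ≤ tail N j
tail≤  : ∀ N j → tail N j ≤ odd⁻¹ N

0≤tail N zero    = ≤-refl
0≤tail N (suc j) = begin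
  0ℚ                              ≡⟨ +-inverseʳ (odd⁻¹ N) ⟨
  odd⁻¹ N - odd⁻¹ N               ≤⟨ +-monoʳ-≤ (odd⁻¹ N) (neg-antimono-≤ (≤-trans (tail≤ (suc N) j) (odd⁻¹-antimono (ℕ.n≤1+n N)))) ⟩
  odd⁻¹ N - tail (suc N) j        ∎
  where open ≤-Reasoning

tail≤ N zero    = <⇒≤ (recip-pos (1 ℕ.+ 2 ℕ.* N))
tail≤ N (suc j) = begin
  odd⁻¹ N - tail (suc N) j        ≤⟨ +-monoʳ-≤ (odd⁻¹ N) (neg-antimono-≤ (0≤tail (suc N) j)) ⟩
  odd⁻¹ N + 0ℚ                    ≡⟨ +-identityʳ (odd⁻¹ N) ⟩
  odd⁻¹ N                         ∎
  where open ≤-Reasoning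

leibniz-tail : ∀ N j → leibniz (j ℕ.+ N) - leibniz N ≡ sign N * tail N j
leibniz-tail N zero    = trans (+-inverseʳ (leibniz N)) (sym (*-zeroʳ (sign N)))
leibniz-tail N (suc j) = begin
  leibniz (suc (j ℕ.+ N)) - leibniz N
    ≡⟨ cong (λ t → leibniz t - leibniz N) (ℕ.+-suc j N) ⟨
  leibniz (j ℕ.+ suc N) - leibniz N
    ≡⟨ solve 4 (λ a l s o → a :- l := (a :- (l :+ s :* o)) :+ s :* o) refl
         (leibniz (j ℕ.+ suc N)) (leibniz N) (sign N) (odd⁻¹ N) ⟩
  (leibniz (j ℕ.+ suc N) - leibniz (suc N)) + sign N * odd⁻¹ N
    ≡⟨ cong (_+ sign N * odd⁻¹ N) (leibniz-tail (suc N) j) ⟩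
  - sign N * tail (suc N) j + sign N * odd⁻¹ N
    ≡⟨ solve 3 (λ s t o → :- s :* t :+ s :* o := s :* (o :- t)) refl (sign N) (tail (suc N) j) (odd⁻¹ N) ⟩
  sign N * (odd⁻¹ N - tail (suc N) j) ∎
  where open ≡-Reasoning

∣sign∣ : ∀ n → ∣ sign n ∣ ≡ 1ℚ
∣sign∣ zero    = refl
∣sign∣ (suc n) = trans (∣-p∣≡∣p∣ (sign n)) (∣sign∣ n)

leibniz-diff : ∀ {N n} → N ℕ.≤ n → ∣ leibniz n - leibniz N ∣ ≤ odd⁻¹ N
leibniz-diff {N} {n} N≤n = begin
  ∣ leibniz n - leibniz N ∣            ≡⟨ cong (λ t → ∣ leibniz t - leibniz N ∣) (ℕ.m∸n+n≡m N≤n) ⟨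
  ∣ leibniz (j ℕ.+ N) - leibniz N ∣    ≡⟨ cong ∣_∣ (leibniz-tail N j) ⟩
  ∣ sign N * tail N j ∣                ≡⟨ ∣p*q∣≡∣p∣*∣q∣ (sign N) (tail N j) ⟩
  ∣ sign N ∣ * ∣ tail N j ∣            ≡⟨ cong₂ _*_ (∣sign∣ N) (0≤p⇒∣p∣≡p (0≤tail N j)) ⟩
  1ℚ * tail N j                        ≡⟨ *-identityˡ (tail N j) ⟩
  tail N j                             ≤⟨ tail≤ N j ⟩
  odd⁻¹ N                              ∎
  where open ≤-Reasoning
        j = n ℕ.∸ N

leibniz-cauchy : IsCauchy leibniz
leibniz-cauchy ε ε>0 with archimedean (½ * (½ * ε)) (half>0 (half>0 ε>0))
... | d , 1/d≤ε/4 = suc d , λ m n N≤m N≤n → begin-strict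
  ∣ leibniz m - leibniz n ∣
    ≡⟨ cong ∣_∣ (solve 3 (λ a b c → a :- b := (a :- c) :- (b :- c)) refl (leibniz m) (leibniz n) (leibniz (suc d))) ⟩
  ∣ (leibniz m - leibniz (suc d)) - (leibniz n - leibniz (suc d)) ∣
    ≤⟨ ∣p-q∣≤∣p∣+∣q∣ (leibniz m - leibniz (suc d)) (leibniz n - leibniz (suc d)) ⟩
  ∣ leibniz m - leibniz (suc d) ∣ + ∣ leibniz n - leibniz (suc d) ∣
    ≤⟨ +-mono-≤ (bound N≤m) (bound N≤n) ⟩
  ½ * (½ * ε) + ½ * (½ * ε)
    ≡⟨ half+half (½ * ε) ⟩
  ½ * ε
    <⟨ half<self ε>0 ⟩
  ε ∎
  where
  open ≤-Reasoning
  bound : ∀ {n} → suc d ℕ.≤ n → ∣ leibniz n - leibniz (suc d) ∣ ≤ ½ * (½ * ε)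
  bound le = ≤-trans (leibniz-diff le) (≤-trans
    (recip-antimono (suc d) (1 ℕ.+ 2 ℕ.* suc d)
      (ℕ.≤-trans (ℕ.m≤n*m (suc d) 2) (ℕ.n≤1+n (2 ℕ.* suc d)))) 1/d≤ε/4)

-- The library has no π; it is taken as four times the sum of the Leibniz series.
π : ℝ
π = fromℚ (+ 4 / 1) *ᴿ mkℝ leibniz leibniz-cauchy

centralBinom : ℕ → ℕ
centralBinom n = (2 ℕ.* n) C n

centralBinom≢0 : ∀ n → NonZero (centralBinom n)
centralBinom≢0 n = subst NonZero (sym (nCk≡n!/k![n-k]! n≤2n))
  (ℕ.>-nonZero (m≥n⇒m/n>0 (∣⇒≤ {{(2 ℕ.* n) ℕ.!≢0}} (k![n∸k]!∣n! n≤2n))))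
  where
  n≤2n : n ℕ.≤ 2 ℕ.* n
  n≤2n = ℕ.m≤n*m n 2
  instance _ = n ℕ.!* (2 ℕ.* n ℕ.∸ n) !≢0

-- binom(2n+2r+2, n+r+1) is centralBinom (n+r+1).
summand : ℕ → (n : ℕ) .{{_ : NonZero n}} → ℚ
summand r n =
  + 1 / ((1 ℕ.+ n) ℕ.* (3 ℕ.+ 2 ℕ.* n) ℕ.* (3 ℕ.+ 2 ℕ.* n ℕ.+ 2 ℕ.* r))
  * (+ centralBinom n / centralBinom (n ℕ.+ r ℕ.+ 1))
  where instance _ = centralBinom≢0 (n ℕ.+ r ℕ.+ 1)

innerSummand : (k : ℕ) .{{_ : NonZero k}} → ℚ
innerSummand k = + (4 ℕ.^ k) / (k ℕ.^ 2 ℕ.* centralBinom k)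
  where instance
    _ = ℕ.m^n≢0 k 2
    _ = centralBinom≢0 k
    _ = ℕ.m*n≢0 (k ℕ.^ 2) (centralBinom k)

closedForm : ℕ → ℝ
closedForm r =
  fromℚ (+ 1 / (2 ℕ.* (1 ℕ.+ 2 ℕ.* r) ℕ.* centralBinom r))
  -ᴿ fromℚ (+ 1 / (3 ℕ.* (3 ℕ.+ 2 ℕ.* r) ℕ.* centralBinom (r ℕ.+ 1)))
  -ᴿ fromℚ (+ 1 / 2 ℕ.^ (2 ℕ.* r ℕ.+ 1))
     *ᴿ (fromℚ (+ 1 / (4 ℕ.* (1 ℕ.+ r)))
         +ᴿ fromℚ (+ centralBinom r / (2 ℕ.* 4 ℕ.^ (r ℕ.+ 1)))
            *ᴿ (fromℚ ½ *ᴿ (π *ᴿ π) +ᴿ fromℚ (sum₁ innerSummand r)))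
  where instance
    _ = centralBinom≢0 r
    _ = centralBinom≢0 (r ℕ.+ 1)
    _ = ℕ.m*n≢0 (2 ℕ.* (1 ℕ.+ 2 ℕ.* r)) (centralBinom r)
    _ = ℕ.m*n≢0 (3 ℕ.* (3 ℕ.+ 2 ℕ.* r)) (centralBinom (r ℕ.+ 1))
    _ = ℕ.m^n≢0 2 (2 ℕ.* r ℕ.+ 1)
    _ = ℕ.m^n≢0 4 (r ℕ.+ 1)
    _ = ℕ.m*n≢0 2 (4 ℕ.^ (r ℕ.+ 1))

{-# OPTIONS --safe #-}

-- All convergence is expressed by null sequences of rationals.
--
-- Write L_N and Q_N for the N-th partial sums of Σ (-1)^k/(2k+1) and
-- Σ 1/(2k+1)², and h for the partial sums of the alternating harmonic series.
-- Partial fractions give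
--   2 L_N² - Q_N = Σ_{i<N} (h(N+i) - h(N-1-i)) / (2i+1),
-- whose i-th term is at most 1/((2i+1)(N-i)) in absolute value, so that
-- 2 L_N² - Q_N = O(log N / N).  This is Σ 1/(2k+1)² = π²/8, and it settles r = 0,
-- where the summand is 1/(2(2n+1)(2n+3)²).
--
-- The summands s_r(n) satisfy
--   8(r+1) s_{r+1}(n) = (2r+1) s_r(n) + G(n+1) - G(n)
-- for a Gosper certificate G whose limit comes from
-- binom(2n,n) / binom(2n+2k,n+k) → 4^(-k); the closed form satisfies the summed
-- recurrence, so the theorem follows by induction on r.
module Submission where

open import Data.Integer.Base as ℤ using (+_)
import Data.Integer.Properties as ℤ
open import Data.Nat.Base as ℕ using (ℕ; zero; suc; NonZero; _!)
open import Data.Nat.Combinatorics using (nCk≡n!/k![n-k]!; k![n∸k]!∣n!)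
open import Data.Nat.DivMod using (m/n*n≡m)
import Data.Nat.Properties as ℕ
open import Data.Nat.Tactic.RingSolver using (solve-∀)
open import Data.Product.Base using (∃; _,_)
open import Data.Rational.Base hiding (NonZero)
open import Data.Rational.Properties
open import Data.Rational.Solver using (module +-*-Solver)
import Data.Rational.Unnormalised.Base as ℚᵘ
import Data.Rational.Unnormalised.Properties as ℚᵘ
open import Relation.Binary.PropositionalEquality using (_≡_; refl; sym; trans; cong; cong₂; subst; module ≡-Reasoning)
open import Defs

open +-*-Solver using (solve; con; _:+_; _:*_; _:-_; :-_; _:=_)

-- Arithmetic of fractions and of natural numbers inside the rationals

ι : ℕ → ℚ
ι n = + n / 1

*-/ : ∀ m n c d .{{_ : NonZero c}} .{{_ : NonZero d}} .{{_ : NonZero (c ℕ.* d)}} →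
      (+ m / c) * (+ n / d) ≡ + (m ℕ.* n) / (c ℕ.* d)
*-/ m n c@(suc _) d@(suc _) = toℚᵘ-injective (begin-equality
  toℚᵘ ((+ m / c) * (+ n / d))              ≃⟨ toℚᵘ-homo-* (+ m / c) (+ n / d) ⟩
  toℚᵘ (+ m / c) ℚᵘ.* toℚᵘ (+ n / d)        ≃⟨ ℚᵘ.*-cong (toℚᵘ-fromℚᵘ (+ m ℚᵘ./ c)) (toℚᵘ-fromℚᵘ (+ n ℚᵘ./ d)) ⟩
  (+ m ℚᵘ./ c) ℚᵘ.* (+ n ℚᵘ./ d)            ≃⟨ ℚᵘ.*≡* (cong (ℤ._* (+ (c ℕ.* d))) (sym (ℤ.pos-* m n))) ⟩
  + (m ℕ.* n) ℚᵘ./ (c ℕ.* d)                ≃⟨ toℚᵘ-fromℚᵘ (+ (m ℕ.* n) ℚᵘ./ (c ℕ.* d)) ⟨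
  toℚᵘ (+ (m ℕ.* n) / (c ℕ.* d))            ∎)
  where open ℚᵘ.≤-Reasoning

/-cong-cross : ∀ m n c d .{{_ : NonZero c}} .{{_ : NonZero d}} →
               m ℕ.* d ≡ n ℕ.* c → + m / c ≡ + n / d
/-cong-cross m n c@(suc _) d@(suc _) eq = fromℚᵘ-cong {+ m ℚᵘ./ c} {+ n ℚᵘ./ d} (ℚᵘ.*≡*
  (trans (sym (ℤ.pos-* m d)) (trans (cong +_ eq) (ℤ.pos-* n c))))

ι-* : ∀ m n → ι (m ℕ.* n) ≡ ι m * ι n
ι-* m n = sym (*-/ m n 1 1)

ι-+ : ∀ m n → ι (m ℕ.+ n) ≡ ι m + ι n
ι-+ m n = toℚᵘ-injective (begin-equality
  toℚᵘ (ι (m ℕ.+ n))              ≃⟨ toℚᵘ-fromℚᵘ (+ (m ℕ.+ n) ℚᵘ./ 1) ⟩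
  + (m ℕ.+ n) ℚᵘ./ 1              ≃⟨ ℚᵘ.*≡* (cong (ℤ._* + 1) (cong₂ ℤ._+_ (ℤ.*-identityʳ (+ m)) (ℤ.*-identityʳ (+ n)))) ⟨
  (+ m ℚᵘ./ 1) ℚᵘ.+ (+ n ℚᵘ./ 1)  ≃⟨ ℚᵘ.+-cong (toℚᵘ-fromℚᵘ (+ m ℚᵘ./ 1)) (toℚᵘ-fromℚᵘ (+ n ℚᵘ./ 1)) ⟨
  toℚᵘ (ι m) ℚᵘ.+ toℚᵘ (ι n)      ≃⟨ toℚᵘ-homo-+ (ι m) (ι n) ⟨
  toℚᵘ (ι m + ι n)                ∎)
  where open ℚᵘ.≤-Reasoning

ι-^ : ∀ m n → ι (m ℕ.^ suc n) ≡ ι m * ι (m ℕ.^ n)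
ι-^ m n = ι-* m (m ℕ.^ n)

ι-inverse : ∀ n .{{_ : NonZero n}} → ι n * (+ 1 / n) ≡ 1ℚ
ι-inverse n@(suc _) = trans (*-/ n 1 1 n) (/-cong-cross (n ℕ.* 1) 1 (1 ℕ.* n) 1
  (trans (ℕ.*-identityʳ (n ℕ.* 1)) (trans (ℕ.*-comm n 1) (sym (ℕ.*-identityˡ (1 ℕ.* n))))))

/-ι : ∀ m n .{{_ : NonZero n}} → + m / n ≡ ι m * (+ 1 / n)
/-ι m n@(suc _) = sym (trans (*-/ m 1 1 n) (/-cong-cross (m ℕ.* 1) m (1 ℕ.* n) n
  (trans (cong (ℕ._* n) (ℕ.*-identityʳ m)) (cong (m ℕ.*_) (sym (ℕ.*-identityˡ n))))))

recip-* : ∀ m n .{{_ : NonZero m}} .{{_ : NonZero n}} .{{_ : NonZero (m ℕ.* n)}} →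
          + 1 / (m ℕ.* n) ≡ (+ 1 / m) * (+ 1 / n)
recip-* m n = sym (*-/ 1 1 m n)

-- Null sequences

Null : (ℕ → ℚ) → Set
Null x = ∀ ε → 0ℚ < ε → ∃ λ N → ∀ n → N ℕ.≤ n → ∣ x n ∣ ≤ ε

null-cong : ∀ {x y} → (∀ n → x n ≡ y n) → Null x → Null y
null-cong eq nx ε ε>0 with nx ε ε>0
... | N , h = N , λ n N≤n → subst (λ t → ∣ t ∣ ≤ ε) (eq n) (h n N≤n)

null-+ : ∀ {x y} → Null x → Null y → Null (λ n → x n + y n)
null-+ {x} {y} nx ny ε ε>0 with nx (½ * ε) (half>0 ε>0) | ny (½ * ε) (half>0 ε>0)
... | N , h | M , k = N ℕ.⊔ M , λ n le → begin
  ∣ x n + y n ∣      ≤⟨ ∣p+q∣≤∣p∣+∣q∣ (x n) (y n) ⟩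
  ∣ x n ∣ + ∣ y n ∣  ≤⟨ +-mono-≤ (h n (ℕ.m⊔n≤o⇒m≤o N M le)) (k n (ℕ.m⊔n≤o⇒n≤o N M le)) ⟩
  ½ * ε + ½ * ε      ≡⟨ half+half ε ⟩
  ε                  ∎
  where open ≤-Reasoning

null-* : ∀ {x y} → Null x → Null y → Null (λ n → x n * y n)
-- It suffices that the first factor is at most ε and the second at most 1, so no square root of ε
-- is taken.
null-* {x} {y} nx ny ε ε>0 with nx ε ε>0 | ny 1ℚ (positive⁻¹ 1ℚ)
... | N , h | M , k = N ℕ.⊔ M , λ n le → begin
  ∣ x n * y n ∣      ≡⟨ ∣p*q∣≡∣p∣*∣q∣ (x n) (y n) ⟩
  ∣ x n ∣ * ∣ y n ∣  ≤⟨ *-mono-≤-nonNeg (0≤∣p∣ (y n)) (<⇒≤ ε>0) (h n (ℕ.m⊔n≤o⇒m≤o N M le)) (k n (ℕ.m⊔n≤o⇒n≤o N M le)) ⟩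
  ε * 1ℚ             ≡⟨ *-identityʳ ε ⟩
  ε                  ∎
  where open ≤-Reasoning

null-scale : ∀ c {x} → Null x → Null (λ n → c * x n)
null-scale c {x} nx ε ε>0 =
  -- `shrink` divides by its first argument, and `c` may be 0; adding 1 makes the divisor positive.
  let S>0 : 0ℚ < ∣ c ∣ + 1ℚ
      S>0 = +-mono-≤-< (0≤∣p∣ c) (positive⁻¹ 1ℚ)
      δ , δ>0 , eq = shrink (∣ c ∣ + 1ℚ) ε S>0 ε>0
      N , h = nx δ δ>0
  in N , λ n le → begin
    ∣ c * x n ∣        ≡⟨ ∣p*q∣≡∣p∣*∣q∣ c (x n) ⟩
    ∣ c ∣ * ∣ x n ∣    ≤⟨ *-mono-≤-nonNeg (0≤∣p∣ (x n)) (<⇒≤ S>0) (p≤p+1 ∣ c ∣) (h n le) ⟩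
    (∣ c ∣ + 1ℚ) * δ   ≡⟨ eq ⟩
    ε                  ∎
  where
  open ≤-Reasoning
  p≤p+1 : ∀ p → p ≤ p + 1ℚ
  p≤p+1 p = ≤-trans (≤-reflexive (sym (+-identityʳ p))) (+-monoʳ-≤ p (<⇒≤ (positive⁻¹ 1ℚ)))

null-shift : ∀ k {x} → Null x → Null (λ n → x (n ℕ.+ k))
null-shift k nx ε ε>0 with nx ε ε>0
... | N , h = N , λ n le → h (n ℕ.+ k) (ℕ.≤-trans le (ℕ.m≤m+n n k))

null-dominated : ∀ {x y} → (∀ n → ∣ x n ∣ ≤ y n) → Null y → Null x
null-dominated {x} {y} dom ny ε ε>0 with ny ε ε>0
... | N , h = N , λ n le → ≤-trans (dom n)
  -- `y n` bounds an absolute value and is therefore nonnegative, so `∣ y n ∣ ≤ ε` reads `y n ≤ ε`.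
  (subst (_≤ ε) (0≤p⇒∣p∣≡p (≤-trans (0≤∣p∣ (x n)) (dom n))) (h n le))

null-recip : Null (λ n → + 1 / suc n)
null-recip ε ε>0 with archimedean ε ε>0
... | d , le = d , λ n d≤n → begin
  ∣ + 1 / suc n ∣   ≡⟨ 0≤p⇒∣p∣≡p (<⇒≤ (recip-pos (suc n))) ⟩
  + 1 / suc n       ≤⟨ recip-antimono (suc d) (suc n) (ℕ.s≤s d≤n) ⟩
  + 1 / suc d       ≤⟨ le ⟩
  ε                 ∎
  where open ≤-Reasoning

-- `HasSum₁` compares one partial sum with all late entries of `x`, whereas the hypothesis compares
-- entries of equal index. The Cauchy property of `x` bridges the two, each contributing ε/2; its
-- modulus `M` also serves as the threshold of the inner comparison, where the slack `ε′` is simply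
-- discarded.
hasSum₁-null : ∀ {f : (k : ℕ) .{{_ : NonZero k}} → ℚ} x → Null (λ n → sum₁ f n - seq x n) → HasSum₁ f x
hasSum₁-null {f} x nx ε ε>0 with nx (½ * ε) (half>0 ε>0) | cauchy x (½ * ε) (half>0 ε>0)
... | N , h | M , k = N ℕ.⊔ M , λ n le ε′ ε′>0 → M , λ m M≤m → begin
  ∣ sum₁ f n - seq x m ∣
    ≡⟨ cong ∣_∣ (solve 3 (λ s y z → s :- z := (s :- y) :+ (y :- z)) refl (sum₁ f n) (seq x n) (seq x m)) ⟩
  ∣ (sum₁ f n - seq x n) + (seq x n - seq x m) ∣
    ≤⟨ ∣p+q∣≤∣p∣+∣q∣ (sum₁ f n - seq x n) (seq x n - seq x m) ⟩
  ∣ sum₁ f n - seq x n ∣ + ∣ seq x n - seq x m ∣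
    ≤⟨ +-mono-≤ (h n (ℕ.m⊔n≤o⇒m≤o N M le)) (<⇒≤ (k n m (ℕ.m⊔n≤o⇒n≤o N M le) M≤m)) ⟩
  ½ * ε + ½ * ε
    ≡⟨ half+half ε ⟩
  ε
    ≡⟨ +-identityʳ ε ⟨
  ε + 0ℚ
    ≤⟨ +-monoʳ-≤ ε (<⇒≤ ε′>0) ⟩
  ε + ε′ ∎
  where open ≤-Reasoning

-- Rational-function identities are proved as polynomial identities with explicit
-- cofactors k for each relation p = (denominator * reciprocal) ≡ 1.
modulo : ∀ {x y p} k → x ≡ y + k * (p - 1ℚ) → p ≡ 1ℚ → x ≡ y
modulo {y = y} k refl refl = trans (cong (λ t → y + k * t) (+-inverseʳ 1ℚ))
  (trans (cong (λ t → y + t) (*-zeroʳ k)) (+-identityʳ y))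

ι-suc : ∀ n → ι (suc n) ≡ ι n + 1ℚ
ι-suc n = trans (ι-+ 1 n) (+-comm 1ℚ (ι n))

ι-odd : ∀ n → ι (1 ℕ.+ 2 ℕ.* n) ≡ (+ 2 / 1) * ι n + 1ℚ
ι-odd n = trans (ι-suc (2 ℕ.* n)) (cong (_+ 1ℚ) (ι-* 2 n))

recip-inverse : ∀ n → (ι n + 1ℚ) * (+ 1 / suc n) ≡ 1ℚ
recip-inverse n = trans (cong (_* (+ 1 / suc n)) (sym (ι-suc n))) (ι-inverse (suc n))

odd⁻¹-inverse : ∀ n → ((+ 2 / 1) * ι n + 1ℚ) * odd⁻¹ n ≡ 1ℚ
odd⁻¹-inverse n = trans (cong (_* odd⁻¹ n) (sym (ι-odd n))) (ι-inverse (1 ℕ.+ 2 ℕ.* n))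

-- Finite sums from index 0 and alternating signs

∑ : (ℕ → ℚ) → ℕ → ℚ
∑ f zero    = 0ℚ
∑ f (suc n) = ∑ f n + f n

∑-cong : ∀ {f g} n → (∀ i → i ℕ.< n → f i ≡ g i) → ∑ f n ≡ ∑ g n
∑-cong zero    eq = refl
∑-cong (suc n) eq = cong₂ _+_ (∑-cong n (λ i i<n → eq i (ℕ.m<n⇒m<1+n i<n))) (eq n (ℕ.n<1+n n))

∑-mono : ∀ {f g} n → (∀ i → i ℕ.< n → f i ≤ g i) → ∑ f n ≤ ∑ g n
∑-mono zero    le = ≤-refl
∑-mono (suc n) le = +-mono-≤ (∑-mono n (λ i i<n → le i (ℕ.m<n⇒m<1+n i<n))) (le n (ℕ.n<1+n n))

∑-+ : ∀ f g n → ∑ (λ i → f i + g i) n ≡ ∑ f n + ∑ g n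
∑-+ f g zero    = refl
∑-+ f g (suc n) = trans (cong (_+ (f n + g n)) (∑-+ f g n))
  (solve 4 (λ a b c d → (a :+ b) :+ (c :+ d) := (a :+ c) :+ (b :+ d)) refl (∑ f n) (∑ g n) (f n) (g n))

∑-* : ∀ c f n → ∑ (λ i → c * f i) n ≡ c * ∑ f n
∑-* c f zero    = sym (*-zeroʳ c)
∑-* c f (suc n) = trans (cong (_+ c * f n) (∑-* c f n)) (sym (*-distribˡ-+ c (∑ f n) (f n)))

∣∑∣≤∑∣∣ : ∀ f n → ∣ ∑ f n ∣ ≤ ∑ (λ i → ∣ f i ∣) n
∣∑∣≤∑∣∣ f zero    = ≤-refl
∣∑∣≤∑∣∣ f (suc n) = ≤-trans (∣p+q∣≤∣p∣+∣q∣ (∑ f n) (f n)) (+-monoˡ-≤ ∣ f n ∣ (∣∑∣≤∑∣∣ f n))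

∑-append : ∀ f m n → ∑ f (m ℕ.+ n) ≡ ∑ f m + ∑ (λ i → f (m ℕ.+ i)) n
∑-append f m zero    = trans (cong (∑ f) (ℕ.+-identityʳ m)) (sym (+-identityʳ (∑ f m)))
∑-append f m (suc n) = trans (cong (∑ f) (ℕ.+-suc m n))
  (trans (cong (_+ f (m ℕ.+ n)) (∑-append f m n)) (+-assoc (∑ f m) _ _))

-- The first summand of the reversed sum is the last summand of `∑ f`; peeling it off leaves a
-- shorter reversed sum.
∑-reverse : ∀ f n → ∑ (λ i → f (n ℕ.∸ suc i)) n ≡ ∑ f n
∑-reverse f zero    = refl
∑-reverse f (suc n) = begin
  ∑ (λ i → f (n ℕ.∸ i)) (1 ℕ.+ n)               ≡⟨ ∑-append (λ i → f (n ℕ.∸ i)) 1 n ⟩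
  (0ℚ + f n) + ∑ (λ i → f (n ℕ.∸ suc i)) n      ≡⟨ cong₂ _+_ (+-identityˡ (f n)) (∑-reverse f n) ⟩
  f n + ∑ f n                                   ≡⟨ +-comm (f n) (∑ f n) ⟩
  ∑ f n + f n                                   ∎
  where open ≡-Reasoning

sign-+ : ∀ m n → sign (m ℕ.+ n) ≡ sign m * sign n
sign-+ zero    n = sym (*-identityˡ (sign n))
sign-+ (suc m) n = trans (cong -_ (sign-+ m n)) (neg-distribˡ-* (sign m) (sign n))

sign² : ∀ n → sign n * sign n ≡ 1ℚ
sign² zero    = refl
sign² (suc n) = trans (solve 1 (λ s → (:- s) :* (:- s) := s :* s) refl (sign n)) (sign² n)

-- Twice the square of the Leibniz series

altHarmonicTerm : ℕ → ℚ
altHarmonicTerm n = sign n * (+ 1 / suc n)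

altHarmonic : ℕ → ℚ
altHarmonic = ∑ altHarmonicTerm

oddSquares : ℕ → ℚ
oddSquares = ∑ (λ k → odd⁻¹ k * odd⁻¹ k)

leibniz-∑ : ∀ n → leibniz n ≡ ∑ (λ k → sign k * odd⁻¹ k) n
leibniz-∑ zero    = refl
leibniz-∑ (suc n) = cong (_+ sign n * odd⁻¹ n) (leibniz-∑ n)

-- Let `P′` and `R′` be the denominators of `P` and `R`. Then 1/u = R′ - P′ and 1/v = P′ + R′, and
-- after clearing denominators the claim is (P′ + R′)² = 4 P′ R′ + (R′ - P′)².
partial-fractions : ∀ i m P R u v →
  (m + 1ℚ) * P ≡ 1ℚ → ((+ 2 / 1) * i + m + (+ 2 / 1)) * R ≡ 1ℚ →
  ((+ 2 / 1) * i + 1ℚ) * u ≡ 1ℚ → ((+ 2 / 1) * (m + i + 1ℚ) + 1ℚ) * v ≡ 1ℚ →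
  u * (P + R) ≡ v * ((+ 4 / 1) * u + (P - R))
partial-fractions i m P R u v hP hR hu hv =
  modulo (- (u * v′ * P * R)) (modulo (v * P * R * u′)
  (modulo ((+ 4 / 1) * u * v - u * R - v * R)
  (modulo ((+ 4 / 1) * u * v * P′ * P - u * P + v * P)
    (solve 6 (λ i m P R u v →
       let two = con (+ 2 / 1) ; four = con (+ 4 / 1) ; one = con 1ℚ
           P′ = m :+ one ; R′ = two :* i :+ m :+ two
           u′ = two :* i :+ one ; v′ = two :* (m :+ i :+ one) :+ one
       in u :* (P :+ R) :=
          v :* (four :* u :+ (P :- R))
          :+ (:- (u :* v′ :* P :* R)) :* (v′ :* v :- one)
          :+ v :* P :* R :* u′ :* (u′ :* u :- one)
          :+ (four :* u :* v :- u :* R :- v :* R) :* (P′ :* P :- one)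
          :+ (four :* u :* v :* P′ :* P :- u :* P :+ v :* P) :* (R′ :* R :- one))
      refl i m P R u v) hR) hP) hu) hv
  where
  P′ = m + 1ℚ
  u′ = (+ 2 / 1) * i + 1ℚ
  v′ = (+ 2 / 1) * (m + i + 1ℚ) + 1ℚ

-- The sign at an even index is +1 and the denominator is 2n+1. This evaluates the last term that
-- enters `kernelSum` when `N` grows.
altHarmonicTerm-even : ∀ n → altHarmonicTerm (n ℕ.+ n) ≡ odd⁻¹ n
altHarmonicTerm-even n = begin
  sign (n ℕ.+ n) * (+ 1 / suc (n ℕ.+ n))    ≡⟨ cong (_* (+ 1 / suc (n ℕ.+ n))) (trans (sign-+ n n) (sign² n)) ⟩
  1ℚ * (+ 1 / suc (n ℕ.+ n))                ≡⟨ *-identityˡ (+ 1 / suc (n ℕ.+ n)) ⟩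
  + 1 / suc (n ℕ.+ n)                       ≡⟨ cong (λ t → + 1 / suc (n ℕ.+ t)) (ℕ.+-identityʳ n) ⟨
  odd⁻¹ n                                   ∎
  where open ≡-Reasoning

ι-suc-+-suc-+ : ∀ i m → ι (suc (m ℕ.+ suc i ℕ.+ i)) ≡ (+ 2 / 1) * ι i + ι m + (+ 2 / 1)
ι-suc-+-suc-+ i m = begin
  ι (suc (m ℕ.+ suc i ℕ.+ i))           ≡⟨ ι-suc (m ℕ.+ suc i ℕ.+ i) ⟩
  ι (m ℕ.+ suc i ℕ.+ i) + 1ℚ            ≡⟨ cong (_+ 1ℚ) (trans (ι-+ (m ℕ.+ suc i) i) (cong (_+ ι i) (trans (ι-+ m (suc i)) (cong (λ t → ι m + t) (ι-suc i))))) ⟩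
  ι m + (ι i + 1ℚ) + ι i + 1ℚ           ≡⟨ solve 2 (λ i m → m :+ (i :+ con 1ℚ) :+ i :+ con 1ℚ := con (+ 2 / 1) :* i :+ m :+ con (+ 2 / 1)) refl (ι i) (ι m) ⟩
  (+ 2 / 1) * ι i + ι m + (+ 2 / 1)     ∎
  where open ≡-Reasoning

ι-+-suc : ∀ m i → ι (m ℕ.+ suc i) ≡ ι m + ι i + 1ℚ
ι-+-suc m i = trans (ι-+ m (suc i)) (trans (cong (λ t → ι m + t) (ι-suc i)) (sym (+-assoc (ι m) (ι i) 1ℚ)))

-- Used with m = N - 1 - i; keeping m separate avoids truncated subtraction.
kernel : ℕ → ℕ → ℕ → ℚ
kernel N i m = odd⁻¹ i * (altHarmonic (N ℕ.+ i) - altHarmonic m)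

-- Raising `N` with `i` fixed appends one term to each alternating sum, at the indices `N + i` and
-- `m`. These differ by 2i+1, so the signs are opposite and the two reciprocals add up.
-- `partial-fractions` then replaces the factor `odd⁻¹ i` by `odd⁻¹ N`, which does not depend on
-- `i`, and produces a Leibniz term plus alternating harmonic terms, all of which can be summed over
-- `i`.
kernel-step : ∀ {N i m} → m ℕ.+ suc i ≡ N →
  kernel (suc N) i (suc m) ≡
  kernel N i m + odd⁻¹ N * ((+ 4 / 1) * sign N * (sign i * odd⁻¹ i) + - 1ℚ * (altHarmonicTerm (N ℕ.+ i) + altHarmonicTerm m))
kernel-step {N} {i} {m} refl = begin
  u * ((h₁ + altHarmonicTerm (N ℕ.+ i)) - (h₂ + sign m * P))
    ≡⟨ cong₂ (λ a b → u * ((h₁ + a) - (h₂ + b * P))) gR sm ⟩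
  u * ((h₁ + σ * R) - (h₂ + - σ * P))
    ≡⟨ solve 6 (λ u a b s P R → u :* ((a :+ s :* R) :- (b :+ :- s :* P)) := u :* (a :- b) :+ s :* (u :* (P :+ R))) refl u h₁ h₂ σ P R ⟩
  u * (h₁ - h₂) + σ * (u * (P + R))
    ≡⟨ cong (λ t → u * (h₁ - h₂) + σ * t) (partial-fractions (ι i) (ι m) P R u v
         (recip-inverse m)
         (trans (cong (_* R) (sym (ι-suc-+-suc-+ i m))) (ι-inverse (suc (N ℕ.+ i))))
         (odd⁻¹-inverse i)
         (trans (cong (λ t → ((+ 2 / 1) * t + 1ℚ) * v) (sym (ι-+-suc m i))) (odd⁻¹-inverse N))) ⟩
  u * (h₁ - h₂) + σ * (v * ((+ 4 / 1) * u + (P - R)))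
    ≡⟨ solve 7 (λ k sN si u v P R → k :+ (sN :* si) :* (v :* (con (+ 4 / 1) :* u :+ (P :- R))) :=
                 k :+ v :* (con (+ 4 / 1) :* sN :* (si :* u) :+ :- con 1ℚ :* ((sN :* si) :* R :+ :- (sN :* si) :* P))) refl (u * (h₁ - h₂)) (sign N) (sign i) u v P R ⟩
  u * (h₁ - h₂) + v * ((+ 4 / 1) * sign N * (sign i * u) + - 1ℚ * (σ * R + - σ * P))
    ≡⟨ cong₂ (λ a b → u * (h₁ - h₂) + v * ((+ 4 / 1) * sign N * (sign i * u) + - 1ℚ * (a + b * P))) gR sm ⟨
  u * (h₁ - h₂) + v * ((+ 4 / 1) * sign N * (sign i * u) + - 1ℚ * (altHarmonicTerm (N ℕ.+ i) + sign m * P)) ∎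
  where
  open ≡-Reasoning
  u = odd⁻¹ i
  v = odd⁻¹ N
  P = + 1 / suc m
  R = + 1 / suc (N ℕ.+ i)
  σ = sign N * sign i
  h₁ = altHarmonic (N ℕ.+ i)
  h₂ = altHarmonic m
  gR : altHarmonicTerm (N ℕ.+ i) ≡ σ * R
  gR = cong (_* R) (sign-+ N i)
  -- N = m + i + 1, so `sign N * sign i` is `sign m` times the square of `sign i`, negated once.
  sm : sign m ≡ - σ
  sm = begin
    sign m                            ≡⟨ *-identityʳ (sign m) ⟨
    sign m * 1ℚ                       ≡⟨ cong (sign m *_) (sign² i) ⟨
    sign m * (sign i * sign i)        ≡⟨ solve 2 (λ a b → a :* (b :* b) := :- ((a :* :- b) :* b)) refl (sign m) (sign i) ⟩
    - (sign m * - sign i * sign i)    ≡⟨ cong (λ t → - (t * sign i)) (sign-+ m (suc i)) ⟨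
    - (sign N * sign i)               ∎

kernelSum : ℕ → ℚ
kernelSum N = ∑ (λ i → kernel N i (N ℕ.∸ suc i)) N

-- Summing `kernel-step` over `i < N` subtracts the alternating harmonic terms of indices N to 2N-1
-- and, in reverse order, 0 to N-1: together `altHarmonic (N + N)`. The new summand i = N has m = 0
-- and contains the same quantity with the opposite sign, plus one further term `odd⁻¹ N`. Only the
-- Leibniz part and the square of `odd⁻¹ N` survive.
kernelSum-step : ∀ N → kernelSum (suc N) ≡ kernelSum N + odd⁻¹ N * ((+ 4 / 1) * sign N * leibniz N + odd⁻¹ N)
kernelSum-step N = begin
  ∑ (λ i → kernel (suc N) i (N ℕ.∸ i)) N + kernel (suc N) N (N ℕ.∸ N)
    ≡⟨ cong₂ _+_ (∑-cong N (λ i i<N → trans (cong (kernel (suc N) i) (ℕ.+-∸-assoc 1 i<N)) (kernel-step (ℕ.m∸n+n≡m i<N))))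
                 (cong (kernel (suc N) N) (ℕ.n∸n≡0 N)) ⟩
  ∑ (λ i → kernel N i (N ℕ.∸ suc i) + v * (4s * (sign i * odd⁻¹ i) + - 1ℚ * (g (N ℕ.+ i) + g (N ℕ.∸ suc i)))) N
    + v * ((h (N ℕ.+ N) + g (N ℕ.+ N)) - 0ℚ)
    ≡⟨ cong₂ _+_ linear (cong (λ t → v * ((h (N ℕ.+ N) + t) - 0ℚ)) (altHarmonicTerm-even N)) ⟩
  (kernelSum N + v * (4s * leibniz N + - 1ℚ * (∑ (λ i → g (N ℕ.+ i)) N + h N))) + v * ((h (N ℕ.+ N) + v) - 0ℚ)
    ≡⟨ cong (λ t → (kernelSum N + v * (4s * leibniz N + - 1ℚ * (∑ (λ i → g (N ℕ.+ i)) N + h N))) + v * ((t + v) - 0ℚ)) (∑-append g N N) ⟩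
  (kernelSum N + v * (4s * leibniz N + - 1ℚ * (∑ (λ i → g (N ℕ.+ i)) N + h N))) + v * ((h N + ∑ (λ i → g (N ℕ.+ i)) N + v) - 0ℚ)
    ≡⟨ solve 5 (λ k v c a b → (k :+ v :* (c :+ :- con 1ℚ :* (a :+ b))) :+ v :* ((b :+ a :+ v) :- con 0ℚ) := k :+ v :* (c :+ v)) refl
         (kernelSum N) v (4s * leibniz N) (∑ (λ i → g (N ℕ.+ i)) N) (h N) ⟩
  kernelSum N + v * (4s * leibniz N + v) ∎
  where
  open ≡-Reasoning
  v = odd⁻¹ N
  4s = (+ 4 / 1) * sign N
  g = altHarmonicTerm
  h = altHarmonic
  k₀ l : ℕ → ℚ
  k₀ i = kernel N i (N ℕ.∸ suc i)
  l i = sign i * odd⁻¹ i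
  gs : ℕ → ℚ
  gs i = g (N ℕ.+ i) + g (N ℕ.∸ suc i)
  linear : ∑ (λ i → k₀ i + v * (4s * l i + - 1ℚ * gs i)) N ≡
           kernelSum N + v * (4s * leibniz N + - 1ℚ * (∑ (λ i → g (N ℕ.+ i)) N + h N))
  linear = begin
    ∑ (λ i → k₀ i + v * (4s * l i + - 1ℚ * gs i)) N
      ≡⟨ ∑-+ k₀ (λ i → v * (4s * l i + - 1ℚ * gs i)) N ⟩
    ∑ k₀ N + ∑ (λ i → v * (4s * l i + - 1ℚ * gs i)) N
      ≡⟨ cong (λ t → ∑ k₀ N + t) (∑-* v (λ i → 4s * l i + - 1ℚ * gs i) N) ⟩
    ∑ k₀ N + v * ∑ (λ i → 4s * l i + - 1ℚ * gs i) N
      ≡⟨ cong (λ t → ∑ k₀ N + v * t) (∑-+ (λ i → 4s * l i) (λ i → - 1ℚ * gs i) N) ⟩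
    ∑ k₀ N + v * (∑ (λ i → 4s * l i) N + ∑ (λ i → - 1ℚ * gs i) N)
      ≡⟨ cong₂ (λ a b → ∑ k₀ N + v * (a + b)) (trans (∑-* 4s l N) (cong (4s *_) (sym (leibniz-∑ N)))) (∑-* (- 1ℚ) gs N) ⟩
    ∑ k₀ N + v * (4s * leibniz N + - 1ℚ * ∑ gs N)
      ≡⟨ cong (λ t → ∑ k₀ N + v * (4s * leibniz N + - 1ℚ * t))
              (trans (∑-+ (λ i → g (N ℕ.+ i)) (λ i → g (N ℕ.∸ suc i)) N) (cong (λ t → ∑ (λ i → g (N ℕ.+ i)) N + t) (∑-reverse g N))) ⟩
    ∑ k₀ N + v * (4s * leibniz N + - 1ℚ * (∑ (λ i → g (N ℕ.+ i)) N + h N)) ∎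

-- Both sides have the same increment: expanding 2(L + sv)² - v² with s² = 1 adds v(4sL + v) to 2L²,
-- which is what `kernelSum-step` gives.
leibniz²-oddSquares : ∀ N → (+ 2 / 1) * (leibniz N * leibniz N) - oddSquares N ≡ kernelSum N
leibniz²-oddSquares zero    = refl
leibniz²-oddSquares (suc N) = begin
  (+ 2 / 1) * ((L + s * v) * (L + s * v)) - (Q + v * v)
    ≡⟨ modulo ((+ 2 / 1) * v * v) (solve 4 (λ L s v Q →
         con (+ 2 / 1) :* ((L :+ s :* v) :* (L :+ s :* v)) :- (Q :+ v :* v) :=
         (con (+ 2 / 1) :* (L :* L) :- Q) :+ v :* (con (+ 4 / 1) :* s :* L :+ v)
         :+ con (+ 2 / 1) :* v :* v :* (s :* s :- con 1ℚ)) refl L s v Q) (sign² N) ⟩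
  ((+ 2 / 1) * (L * L) - Q) + v * ((+ 4 / 1) * s * L + v)
    ≡⟨ cong (_+ v * ((+ 4 / 1) * s * L + v)) (leibniz²-oddSquares N) ⟩
  kernelSum N + v * ((+ 4 / 1) * s * L + v)
    ≡⟨ kernelSum-step N ⟨
  kernelSum (suc N) ∎
  where
  open ≡-Reasoning
  L = leibniz N
  s = sign N
  v = odd⁻¹ N
  Q = oddSquares N

-- Alternating tails and the decay of the kernel sum

altTail : ℕ → ℕ → ℚ
altTail m zero    = 0ℚ
altTail m (suc j) = + 1 / suc m - altTail (suc m) j

-- `altTail m j` is a block of j alternating harmonic terms from index m with its leading sign
-- factored out. The two bounds need each other: the upper bound for the block starting one later,
-- together with the decrease of the reciprocals, gives the lower bound here, and the lower bound
-- there gives the upper bound here.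
0≤altTail : ∀ m j → 0ℚ ≤ altTail m j
altTail≤  : ∀ m j → altTail m j ≤ + 1 / suc m

0≤altTail m zero    = ≤-refl
0≤altTail m (suc j) = p≤q⇒0≤q-p (≤-trans (altTail≤ (suc m) j) (recip-antimono (suc m) (suc (suc m)) (ℕ.n≤1+n (suc m))))
  where
  p≤q⇒0≤q-p : ∀ {p q} → p ≤ q → 0ℚ ≤ q - p
  p≤q⇒0≤q-p {p} {q} p≤q = subst (_≤ q - p) (+-inverseʳ p) (+-monoˡ-≤ (- p) p≤q)

altTail≤ m zero    = <⇒≤ (recip-pos (suc m))
altTail≤ m (suc j) = subst (+ 1 / suc m - altTail (suc m) j ≤_) (+-identityʳ (+ 1 / suc m))
  (+-monoʳ-≤ (+ 1 / suc m) (neg-antimono-≤ (0≤altTail (suc m) j)))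

altHarmonic-tail : ∀ m j → altHarmonic (j ℕ.+ m) - altHarmonic m ≡ sign m * altTail m j
altHarmonic-tail m zero    = trans (+-inverseʳ (altHarmonic m)) (sym (*-zeroʳ (sign m)))
altHarmonic-tail m (suc j) = begin
  altHarmonic (suc j ℕ.+ m) - altHarmonic m
    ≡⟨ cong (λ t → altHarmonic t - altHarmonic m) (ℕ.+-suc j m) ⟨
  altHarmonic (j ℕ.+ suc m) - altHarmonic m
    ≡⟨ solve 4 (λ a h s p → a :- h := (a :- (h :+ s :* p)) :+ s :* p) refl
         (altHarmonic (j ℕ.+ suc m)) (altHarmonic m) (sign m) (+ 1 / suc m) ⟩
  (altHarmonic (j ℕ.+ suc m) - altHarmonic (suc m)) + sign m * (+ 1 / suc m)
    ≡⟨ cong (_+ sign m * (+ 1 / suc m)) (altHarmonic-tail (suc m) j) ⟩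
  - sign m * altTail (suc m) j + sign m * (+ 1 / suc m)
    ≡⟨ solve 3 (λ s t p → :- s :* t :+ s :* p := s :* (p :- t)) refl (sign m) (altTail (suc m) j) (+ 1 / suc m) ⟩
  sign m * altTail m (suc j) ∎
  where open ≡-Reasoning

altHarmonic-diff : ∀ m j → ∣ altHarmonic (j ℕ.+ m) - altHarmonic m ∣ ≤ + 1 / suc m
altHarmonic-diff m j = begin
  ∣ altHarmonic (j ℕ.+ m) - altHarmonic m ∣    ≡⟨ cong ∣_∣ (altHarmonic-tail m j) ⟩
  ∣ sign m * altTail m j ∣                     ≡⟨ ∣p*q∣≡∣p∣*∣q∣ (sign m) (altTail m j) ⟩
  ∣ sign m ∣ * ∣ altTail m j ∣                 ≡⟨ cong₂ _*_ (∣sign∣ m) (0≤p⇒∣p∣≡p (0≤altTail m j)) ⟩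
  1ℚ * altTail m j                             ≡⟨ *-identityˡ (altTail m j) ⟩
  altTail m j                                  ≤⟨ altTail≤ m j ⟩
  + 1 / suc m                                  ∎
  where open ≤-Reasoning

0≤recip : ∀ n .{{_ : NonZero n}} → 0ℚ ≤ + 1 / n
0≤recip n = <⇒≤ (recip-pos n)

odd⁻¹≤recip : ∀ n → odd⁻¹ n ≤ + 1 / suc n
odd⁻¹≤recip n = recip-antimono (suc n) (1 ℕ.+ 2 ℕ.* n) (ℕ.s≤s (ℕ.m≤n*m n 2))

-- Partial fractions from 2N+1 = (2i+1) + 2(m+1).
odd⁻¹*recip : ∀ {N i m} → m ℕ.+ suc i ≡ N →
  odd⁻¹ i * (+ 1 / suc m) ≡ odd⁻¹ N * ((+ 1 / suc m) + (+ 2 / 1) * odd⁻¹ i)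
odd⁻¹*recip {N} {i} {m} refl =
  modulo (- (u * P)) (modulo (v * P) (modulo ((+ 2 / 1) * u * v)
    (solve 5 (λ i m u v P → let two = con (+ 2 / 1) ; one = con 1ℚ in
       u :* P :=
       v :* (P :+ two :* u)
       :+ (:- (u :* P)) :* ((two :* (m :+ i :+ one) :+ one) :* v :- one)
       :+ v :* P :* ((two :* i :+ one) :* u :- one)
       :+ two :* u :* v :* ((m :+ one) :* P :- one)) refl (ι i) (ι m) u v P)
    (recip-inverse m)) (odd⁻¹-inverse i))
    (trans (cong (λ t → ((+ 2 / 1) * t + 1ℚ) * v) (sym (ι-+-suc m i))) (odd⁻¹-inverse N))
  where
  u = odd⁻¹ i
  v = odd⁻¹ N
  P = + 1 / suc m

harmonic : ℕ → ℚ
harmonic = ∑ (λ i → + 1 / suc i)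

-- Since N + i = m + (2i+1), the alternating sums differ by a block starting at index m, hence by at
-- most 1/(m+1). Splitting the product with `odd⁻¹*recip` extracts a factor of order 1/N, and odd
-- denominators are then weakened to consecutive ones so that harmonic sums appear.
kernel-bound : ∀ {N i m} → m ℕ.+ suc i ≡ N →
  ∣ kernel N i m ∣ ≤ (+ 1 / suc N) * ((+ 1 / suc m) + (+ 2 / 1) * (+ 1 / suc i))
kernel-bound {N} {i} {m} eq = begin
  ∣ odd⁻¹ i * (altHarmonic (N ℕ.+ i) - altHarmonic m) ∣
    ≡⟨ ∣p*q∣≡∣p∣*∣q∣ (odd⁻¹ i) (altHarmonic (N ℕ.+ i) - altHarmonic m) ⟩
  ∣ odd⁻¹ i ∣ * ∣ altHarmonic (N ℕ.+ i) - altHarmonic m ∣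
    ≡⟨ cong₂ (λ a b → a * ∣ altHarmonic b - altHarmonic m ∣) (0≤p⇒∣p∣≡p (0≤recip (1 ℕ.+ 2 ℕ.* i))) index ⟩
  odd⁻¹ i * ∣ altHarmonic (suc i ℕ.+ i ℕ.+ m) - altHarmonic m ∣
    ≤⟨ *-monoˡ-≤-nonNeg (odd⁻¹ i) {{nonNegative (0≤recip (1 ℕ.+ 2 ℕ.* i))}} (altHarmonic-diff m (suc i ℕ.+ i)) ⟩
  odd⁻¹ i * (+ 1 / suc m)
    ≡⟨ odd⁻¹*recip eq ⟩
  odd⁻¹ N * ((+ 1 / suc m) + (+ 2 / 1) * odd⁻¹ i)
    ≤⟨ *-mono-≤-nonNeg
         (+-mono-≤ (0≤recip (suc m)) (*-monoˡ-≤-nonNeg (+ 2 / 1) (0≤recip (1 ℕ.+ 2 ℕ.* i))))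
         (0≤recip (suc N)) (odd⁻¹≤recip N)
         (+-monoʳ-≤ (+ 1 / suc m) (*-monoˡ-≤-nonNeg (+ 2 / 1) (odd⁻¹≤recip i))) ⟩
  (+ 1 / suc N) * ((+ 1 / suc m) + (+ 2 / 1) * (+ 1 / suc i)) ∎
  where
  open ≤-Reasoning
  index : N ℕ.+ i ≡ suc i ℕ.+ i ℕ.+ m
  index = trans (cong (ℕ._+ i) (sym eq)) (trans (ℕ.+-assoc m (suc i) i) (ℕ.+-comm m (suc i ℕ.+ i)))

-- Over `i < N` both reciprocals in `kernel-bound` run through 1, ..., 1/N, one of them backwards
-- with weight 1 and the other with weight 2; hence the 3.
kernelSum-bound : ∀ N → ∣ kernelSum N ∣ ≤ (+ 3 / 1) * ((+ 1 / suc N) * harmonic N)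
kernelSum-bound N = begin
  ∣ kernelSum N ∣
    ≤⟨ ∣∑∣≤∑∣∣ (λ i → kernel N i (N ℕ.∸ suc i)) N ⟩
  ∑ (λ i → ∣ kernel N i (N ℕ.∸ suc i) ∣) N
    ≤⟨ ∑-mono N (λ i i<N → kernel-bound (ℕ.m∸n+n≡m i<N)) ⟩
  ∑ (λ i → (+ 1 / suc N) * (q (N ℕ.∸ suc i) + (+ 2 / 1) * q i)) N
    ≡⟨ ∑-* (+ 1 / suc N) (λ i → q (N ℕ.∸ suc i) + (+ 2 / 1) * q i) N ⟩
  (+ 1 / suc N) * ∑ (λ i → q (N ℕ.∸ suc i) + (+ 2 / 1) * q i) N
    ≡⟨ cong ((+ 1 / suc N) *_) (trans (∑-+ (λ i → q (N ℕ.∸ suc i)) (λ i → (+ 2 / 1) * q i) N)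
         (cong₂ _+_ (∑-reverse q N) (∑-* (+ 2 / 1) q N))) ⟩
  (+ 1 / suc N) * (harmonic N + (+ 2 / 1) * harmonic N)
    ≡⟨ solve 2 (λ p h → p :* (h :+ con (+ 2 / 1) :* h) := con (+ 3 / 1) :* (p :* h)) refl (+ 1 / suc N) (harmonic N) ⟩
  (+ 3 / 1) * ((+ 1 / suc N) * harmonic N) ∎
  where
  open ≤-Reasoning
  q : ℕ → ℚ
  q i = + 1 / suc i

∑-const : ∀ c n → ∑ (λ _ → c) n ≡ ι n * c
∑-const c zero    = sym (*-zeroˡ c)
∑-const c (suc n) = trans (cong (_+ c) (∑-const c n))
  (trans (solve 2 (λ a c → a :* c :+ c := (a :+ con 1ℚ) :* c) refl (ι n) c) (cong (_* c) (sym (ι-suc n))))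

0≤ι : ∀ n → 0ℚ ≤ ι n
0≤ι n = nonNegative⁻¹ (ι n) {{normalize-nonNeg n 1}}

-- The first k terms are at most 1 and each later one is at most 1/(k+1). This is crude, but enough
-- for the mean of the terms to tend to 0 without logarithms.
harmonic-bound : ∀ k j → harmonic (k ℕ.+ j) ≤ ι k + ι j * (+ 1 / suc k)
harmonic-bound k j = begin
  harmonic (k ℕ.+ j)
    ≡⟨ ∑-append (λ i → + 1 / suc i) k j ⟩
  harmonic k + ∑ (λ i → + 1 / suc (k ℕ.+ i)) j
    ≤⟨ +-mono-≤ (∑-mono k (λ i _ → recip-antimono 1 (suc i) (ℕ.s≤s ℕ.z≤n)))
                (∑-mono j (λ i _ → recip-antimono (suc k) (suc (k ℕ.+ i)) (ℕ.s≤s (ℕ.m≤m+n k i)))) ⟩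
  ∑ (λ _ → 1ℚ) k + ∑ (λ _ → + 1 / suc k) j
    ≡⟨ cong₂ _+_ (trans (∑-const 1ℚ k) (*-identityʳ (ι k))) (∑-const (+ 1 / suc k) j) ⟩
  ι k + ι j * (+ 1 / suc k) ∎
  where open ≤-Reasoning

0≤harmonic : ∀ n → 0ℚ ≤ harmonic n
0≤harmonic n = subst (_≤ harmonic n) (trans (∑-const 0ℚ n) (*-zeroʳ (ι n))) (∑-mono n (λ i _ → 0≤recip (suc i)))

0≤* : ∀ {p q} → 0ℚ ≤ p → 0ℚ ≤ q → 0ℚ ≤ p * q
0≤* {p} {q} 0≤p 0≤q = subst (_≤ p * q) (*-zeroʳ p) (*-monoˡ-≤-nonNeg p {{nonNegative 0≤p}} 0≤q)

ι-mono : ∀ {m n} → m ℕ.≤ n → ι m ≤ ι n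
ι-mono {m} {n} m≤n = begin
  ι m                  ≡⟨ +-identityʳ (ι m) ⟨
  ι m + 0ℚ             ≤⟨ +-monoʳ-≤ (ι m) (0≤ι (n ℕ.∸ m)) ⟩
  ι m + ι (n ℕ.∸ m)    ≡⟨ ι-+ m (n ℕ.∸ m) ⟨
  ι (m ℕ.+ (n ℕ.∸ m))  ≡⟨ cong ι (ℕ.m+[n∸m]≡n m≤n) ⟩
  ι n                  ∎
  where open ≤-Reasoning

-- Splitting the harmonic sum at a fixed k bounds its mean by k/n + 1/k.
null-harmonic : Null (λ n → (+ 1 / suc n) * harmonic n)
null-harmonic ε ε>0 =
  let k , 1/k≤ = archimedean (½ * ε) (half>0 ε>0)
      M , h    = null-scale (ι k) null-recip (½ * ε) (half>0 ε>0)
  in k ℕ.⊔ M , λ n le → bound k 1/k≤ n (n ℕ.∸ k)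
       (sym (ℕ.m+[n∸m]≡n (ℕ.m⊔n≤o⇒m≤o k M le)))
       (subst (_≤ ½ * ε) (0≤p⇒∣p∣≡p (0≤* (0≤ι k) (0≤recip (suc n)))) (h n (ℕ.m⊔n≤o⇒n≤o k M le)))
  where
  open ≤-Reasoning
  bound : ∀ k → + 1 / suc k ≤ ½ * ε → ∀ n j → n ≡ k ℕ.+ j → ι k * (+ 1 / suc n) ≤ ½ * ε →
          ∣ (+ 1 / suc n) * harmonic n ∣ ≤ ε
  bound k 1/k≤ n j refl le = begin
    ∣ p * harmonic n ∣                        ≡⟨ 0≤p⇒∣p∣≡p (0≤* (0≤recip (suc n)) (0≤harmonic n)) ⟩
    p * harmonic n                            ≤⟨ *-monoˡ-≤-nonNeg p {{nonNegative (0≤recip (suc n))}} (harmonic-bound k j) ⟩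
    p * (ι k + ι j * (+ 1 / suc k))           ≡⟨ solve 4 (λ p k j q → p :* (k :+ j :* q) := k :* p :+ j :* p :* q) refl p (ι k) (ι j) (+ 1 / suc k) ⟩
    ι k * p + ι j * p * (+ 1 / suc k)         ≤⟨ +-mono-≤ le (*-mono-≤-nonNeg (0≤recip (suc k)) (<⇒≤ (positive⁻¹ 1ℚ)) jp≤1 1/k≤) ⟩
    ½ * ε + 1ℚ * (½ * ε)                      ≡⟨ cong (λ t → ½ * ε + t) (*-identityˡ (½ * ε)) ⟩
    ½ * ε + ½ * ε                             ≡⟨ half+half ε ⟩
    ε                                         ∎
    where
    p = + 1 / suc n
    jp≤1 : ι j * p ≤ 1ℚ
    jp≤1 = begin
      ι j * p         ≤⟨ *-monoʳ-≤-nonNeg p {{nonNegative (0≤recip (suc n))}} (ι-mono (ℕ.m≤n⇒m≤1+n (ℕ.m≤n+m j k))) ⟩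
      ι (suc n) * p   ≡⟨ ι-inverse (suc n) ⟩
      1ℚ              ∎

null-kernelSum : Null kernelSum
null-kernelSum = null-dominated kernelSum-bound (null-scale (+ 3 / 1) null-harmonic)

null-odd⁻¹ : Null odd⁻¹
null-odd⁻¹ = null-dominated
  (λ n → ≤-trans (≤-reflexive (0≤p⇒∣p∣≡p (0≤recip (1 ℕ.+ 2 ℕ.* n)))) (odd⁻¹≤recip n)) null-recip

-- Central binomial coefficients

centralBinom-! : ∀ n → centralBinom n ℕ.* (n ! ℕ.* n !) ≡ (2 ℕ.* n) !
centralBinom-! n = begin
  centralBinom n ℕ.* (n ! ℕ.* n !)
    ≡⟨ cong (λ t → centralBinom n ℕ.* (n ! ℕ.* t !)) 2n∸n≡n ⟨
  centralBinom n ℕ.* (n ! ℕ.* (2 ℕ.* n ℕ.∸ n) !)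
    ≡⟨ cong (ℕ._* (n ! ℕ.* (2 ℕ.* n ℕ.∸ n) !)) (nCk≡n!/k![n-k]! n≤2n) ⟩
  (2 ℕ.* n) ! ℕ./ (n ! ℕ.* (2 ℕ.* n ℕ.∸ n) !) ℕ.* (n ! ℕ.* (2 ℕ.* n ℕ.∸ n) !)
    ≡⟨ m/n*n≡m (k![n∸k]!∣n! n≤2n) ⟩
  (2 ℕ.* n) ! ∎
  where
  open ≡-Reasoning
  n≤2n : n ℕ.≤ 2 ℕ.* n
  n≤2n = ℕ.m≤n*m n 2
  2n∸n≡n : 2 ℕ.* n ℕ.∸ n ≡ n
  2n∸n≡n = trans (ℕ.m+n∸m≡n n (n ℕ.+ 0)) (ℕ.+-identityʳ n)
  instance _ = n ℕ.!* (2 ℕ.* n ℕ.∸ n) !≢0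

-- After multiplication by (n+1) n!², both sides equal (2n+2)! by `centralBinom-!`, and the common
-- factor is cancelled.
centralBinom-suc : ∀ n → suc n ℕ.* centralBinom (suc n) ≡ 2 ℕ.* (1 ℕ.+ 2 ℕ.* n) ℕ.* centralBinom n
centralBinom-suc n = ℕ.*-cancelˡ-≡ _ _ (suc n ℕ.* (n ! ℕ.* n !)) (begin
  suc n ℕ.* (n ! ℕ.* n !) ℕ.* (suc n ℕ.* centralBinom (suc n))
    ≡⟨ regroupˡ (suc n) (n !) (centralBinom (suc n)) ⟩
  centralBinom (suc n) ℕ.* (suc n ! ℕ.* suc n !)
    ≡⟨ centralBinom-! (suc n) ⟩
  (2 ℕ.* suc n) !
    ≡⟨ cong _! (ℕ.*-suc 2 n) ⟩
  (2 ℕ.+ 2 ℕ.* n) ℕ.* ((1 ℕ.+ 2 ℕ.* n) ℕ.* (2 ℕ.* n) !)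
    ≡⟨ cong (λ t → (2 ℕ.+ 2 ℕ.* n) ℕ.* ((1 ℕ.+ 2 ℕ.* n) ℕ.* t)) (centralBinom-! n) ⟨
  (2 ℕ.+ 2 ℕ.* n) ℕ.* ((1 ℕ.+ 2 ℕ.* n) ℕ.* (centralBinom n ℕ.* (n ! ℕ.* n !)))
    ≡⟨ regroupʳ n (n !) (centralBinom n) ⟩
  suc n ℕ.* (n ! ℕ.* n !) ℕ.* (2 ℕ.* (1 ℕ.+ 2 ℕ.* n) ℕ.* centralBinom n) ∎)
  where
  open ≡-Reasoning
  regroupˡ : ∀ s f b → s ℕ.* (f ℕ.* f) ℕ.* (s ℕ.* b) ≡ b ℕ.* ((s ℕ.* f) ℕ.* (s ℕ.* f))
  regroupˡ = solve-∀
  regroupʳ : ∀ n f b → (2 ℕ.+ 2 ℕ.* n) ℕ.* ((1 ℕ.+ 2 ℕ.* n) ℕ.* (b ℕ.* (f ℕ.* f))) ≡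
                       (1 ℕ.+ n) ℕ.* (f ℕ.* f) ℕ.* (2 ℕ.* (1 ℕ.+ 2 ℕ.* n) ℕ.* b)
  regroupʳ = solve-∀
  instance
    _ = n ℕ.!* n !≢0
    _ = ℕ.m*n≢0 (suc n) (n ! ℕ.* n !)

-- The coefficient and its reciprocal are separate atoms for the ring solver, linked by
-- `binom-inverse`.
binom binom⁻¹ : ℕ → ℚ
binom n   = ι (centralBinom n)
binom⁻¹ n = + 1 / centralBinom n
  where instance _ = centralBinom≢0 n

binom-inverse : ∀ n → binom n * binom⁻¹ n ≡ 1ℚ
binom-inverse n = ι-inverse (centralBinom n)
  where instance _ = centralBinom≢0 n

binom-suc : ∀ n → binom (suc n) ≡ (+ 2 / 1) * ((+ 2 / 1) * ι n + 1ℚ) * (+ 1 / suc n) * binom n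
binom-suc n = modulo (- binom (suc n)) (begin
  binom (suc n)
    ≡⟨ solve 3 (λ x a B′ → B′ := ((x :+ con 1ℚ) :* B′) :* a :+ (:- B′) :* ((x :+ con 1ℚ) :* a :- con 1ℚ)) refl x a (binom (suc n)) ⟩
  ((x + 1ℚ) * binom (suc n)) * a + - binom (suc n) * ((x + 1ℚ) * a - 1ℚ)
    ≡⟨ cong (λ t → t * a + - binom (suc n) * ((x + 1ℚ) * a - 1ℚ)) rec ⟩
  ((+ 2 / 1) * ((+ 2 / 1) * x + 1ℚ) * binom n) * a + - binom (suc n) * ((x + 1ℚ) * a - 1ℚ)
    ≡⟨ cong (λ t → t + - binom (suc n) * ((x + 1ℚ) * a - 1ℚ))
         (solve 3 (λ k a B → (k :* B) :* a := k :* a :* B) refl ((+ 2 / 1) * ((+ 2 / 1) * x + 1ℚ)) a (binom n)) ⟩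
  (+ 2 / 1) * ((+ 2 / 1) * x + 1ℚ) * a * binom n + - binom (suc n) * ((x + 1ℚ) * a - 1ℚ) ∎)
  (recip-inverse n)
  where
  open ≡-Reasoning
  x = ι n
  a = + 1 / suc n
  rec : (x + 1ℚ) * binom (suc n) ≡ (+ 2 / 1) * ((+ 2 / 1) * x + 1ℚ) * binom n
  rec = begin
    (x + 1ℚ) * binom (suc n)                              ≡⟨ cong (_* binom (suc n)) (ι-suc n) ⟨
    ι (suc n) * binom (suc n)                             ≡⟨ ι-* (suc n) (centralBinom (suc n)) ⟨
    ι (suc n ℕ.* centralBinom (suc n))                    ≡⟨ cong ι (centralBinom-suc n) ⟩
    ι (2 ℕ.* (1 ℕ.+ 2 ℕ.* n) ℕ.* centralBinom n)          ≡⟨ ι-* (2 ℕ.* (1 ℕ.+ 2 ℕ.* n)) (centralBinom n) ⟩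
    ι (2 ℕ.* (1 ℕ.+ 2 ℕ.* n)) * binom n                   ≡⟨ cong (_* binom n) (trans (ι-* 2 (1 ℕ.+ 2 ℕ.* n)) (cong ((+ 2 / 1) *_) (ι-odd n))) ⟩
    (+ 2 / 1) * ((+ 2 / 1) * x + 1ℚ) * binom n            ∎

binom⁻¹-suc : ∀ n → binom⁻¹ n ≡ (+ 2 / 1) * ((+ 2 / 1) * ι n + 1ℚ) * (+ 1 / suc n) * binom⁻¹ (suc n)
binom⁻¹-suc n = modulo (- V) (modulo (k * V′) (begin
  V
    ≡⟨ solve 4 (λ V V′ B′ k → V := V :* V′ :* B′ :+ (:- V) :* (B′ :* V′ :- con 1ℚ)) refl V V′ B′ k ⟩
  V * V′ * B′ + - V * (B′ * V′ - 1ℚ)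
    ≡⟨ cong (λ t → V * V′ * t + - V * (B′ * V′ - 1ℚ)) (binom-suc n) ⟩
  V * V′ * (k * B) + - V * (B′ * V′ - 1ℚ)
    ≡⟨ solve 5 (λ V V′ B B′ k → V :* V′ :* (k :* B) :+ (:- V) :* (B′ :* V′ :- con 1ℚ) :=
         k :* V′ :+ (:- V) :* (B′ :* V′ :- con 1ℚ) :+ k :* V′ :* (B :* V :- con 1ℚ)) refl V V′ B B′ k ⟩
  k * V′ + - V * (B′ * V′ - 1ℚ) + k * V′ * (B * V - 1ℚ) ∎)
  (binom-inverse n)) (binom-inverse (suc n))
  where
  open ≡-Reasoning
  V = binom⁻¹ n
  V′ = binom⁻¹ (suc n)
  B = binom n
  B′ = binom (suc n)
  k = (+ 2 / 1) * ((+ 2 / 1) * ι n + 1ℚ) * (+ 1 / suc n)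

-- The factor 2n+1 in the recurrence for central binomials cancels `odd⁻¹ n`. Products of this shape
-- are the leading terms of the closed form, which can thus be written over a later binomial.
odd⁻¹*binom⁻¹ : ∀ n → odd⁻¹ n * binom⁻¹ n ≡ (+ 2 / 1) * (+ 1 / suc n) * binom⁻¹ (suc n)
odd⁻¹*binom⁻¹ n = modulo ((+ 2 / 1) * a * V′) (trans (cong (odd⁻¹ n *_) (binom⁻¹-suc n))
  (solve 4 (λ x o a V′ → o :* (con (+ 2 / 1) :* (con (+ 2 / 1) :* x :+ con 1ℚ) :* a :* V′) :=
     con (+ 2 / 1) :* a :* V′ :+ con (+ 2 / 1) :* a :* V′ :* ((con (+ 2 / 1) :* x :+ con 1ℚ) :* o :- con 1ℚ))
     refl (ι n) (odd⁻¹ n) a V′)) (odd⁻¹-inverse n)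
  where
  a = + 1 / suc n
  V′ = binom⁻¹ (suc n)

binom⁻¹-pred : ∀ n → binom⁻¹ (suc n) ≡ ½ * (ι n + 1ℚ) * odd⁻¹ n * binom⁻¹ n
binom⁻¹-pred n = sym (modulo V′ (begin
  ½ * (ι n + 1ℚ) * o * V
    ≡⟨ solve 3 (λ k o V → k :* o :* V := k :* (o :* V)) refl (½ * (ι n + 1ℚ)) o V ⟩
  ½ * (ι n + 1ℚ) * (o * V)
    ≡⟨ cong (½ * (ι n + 1ℚ) *_) (odd⁻¹*binom⁻¹ n) ⟩
  ½ * (ι n + 1ℚ) * ((+ 2 / 1) * a * V′)
    ≡⟨ solve 3 (λ x a V′ → con ½ :* (x :+ con 1ℚ) :* (con (+ 2 / 1) :* a :* V′) := V′ :+ V′ :* ((x :+ con 1ℚ) :* a :- con 1ℚ)) refl (ι n) a V′ ⟩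
  V′ + V′ * ((ι n + 1ℚ) * a - 1ℚ) ∎) (recip-inverse n))
  where
  open ≡-Reasoning
  a = + 1 / suc n
  o = odd⁻¹ n
  V = binom⁻¹ n
  V′ = binom⁻¹ (suc n)

-- Normal forms of the summand and of the closed form

summandℚ : ℕ → ℕ → ℚ
summandℚ r n = (+ 1 / suc n) * odd⁻¹ (suc n) * odd⁻¹ (suc (n ℕ.+ r)) * (binom n * binom⁻¹ (suc (n ℕ.+ r)))

summand-normal : ∀ r n .{{_ : NonZero n}} → summand r n ≡ summandℚ r n
summand-normal r n = cong₂ _*_ rational binomial
  where
  open ≡-Reasoning
  instance
    _ = centralBinom≢0 (n ℕ.+ r ℕ.+ 1)
  odd-eq : ∀ k → 3 ℕ.+ 2 ℕ.* k ≡ 1 ℕ.+ 2 ℕ.* suc k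
  odd-eq k = cong suc (sym (ℕ.*-suc 2 k))
  odd-eq₂ : 3 ℕ.+ 2 ℕ.* n ℕ.+ 2 ℕ.* r ≡ 1 ℕ.+ 2 ℕ.* suc (n ℕ.+ r)
  odd-eq₂ = trans (cong (3 ℕ.+_) (sym (ℕ.*-distribˡ-+ 2 n r))) (odd-eq (n ℕ.+ r))
  rational : + 1 / ((1 ℕ.+ n) ℕ.* (3 ℕ.+ 2 ℕ.* n) ℕ.* (3 ℕ.+ 2 ℕ.* n ℕ.+ 2 ℕ.* r)) ≡
             (+ 1 / suc n) * odd⁻¹ (suc n) * odd⁻¹ (suc (n ℕ.+ r))
  rational = begin
    + 1 / ((1 ℕ.+ n) ℕ.* (3 ℕ.+ 2 ℕ.* n) ℕ.* (3 ℕ.+ 2 ℕ.* n ℕ.+ 2 ℕ.* r))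
      ≡⟨ recip-* ((1 ℕ.+ n) ℕ.* (3 ℕ.+ 2 ℕ.* n)) (3 ℕ.+ 2 ℕ.* n ℕ.+ 2 ℕ.* r) ⟩
    (+ 1 / ((1 ℕ.+ n) ℕ.* (3 ℕ.+ 2 ℕ.* n))) * (+ 1 / (3 ℕ.+ 2 ℕ.* n ℕ.+ 2 ℕ.* r))
      ≡⟨ cong₂ _*_ (trans (recip-* (1 ℕ.+ n) (3 ℕ.+ 2 ℕ.* n)) (cong ((+ 1 / suc n) *_) (/-cong (refl {x = + 1}) (odd-eq n)))) (/-cong (refl {x = + 1}) odd-eq₂) ⟩
    (+ 1 / suc n) * odd⁻¹ (suc n) * odd⁻¹ (suc (n ℕ.+ r)) ∎
  binomial : + centralBinom n / centralBinom (n ℕ.+ r ℕ.+ 1) ≡ binom n * binom⁻¹ (suc (n ℕ.+ r))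
  binomial = trans (/-ι (centralBinom n) (centralBinom (n ℕ.+ r ℕ.+ 1)))
    (cong (λ t → binom n * binom⁻¹ t) (ℕ.+-comm (n ℕ.+ r) 1))

4^-_ : ℕ → ℚ
4^- r = + 1 / 4 ℕ.^ r
  where instance _ = ℕ.m^n≢0 4 r

4^-inverse : ∀ r → ι (4 ℕ.^ r) * 4^- r ≡ 1ℚ
4^-inverse r = ι-inverse (4 ℕ.^ r)
  where instance _ = ℕ.m^n≢0 4 r

4^-suc : ∀ r → 4^- suc r ≡ (+ 1 / 4) * 4^- r
4^-suc r = recip-* 4 (4 ℕ.^ r)
  where instance
    _ = ℕ.m^n≢0 4 r
    _ = ℕ.m^n≢0 4 (suc r)

-- `X` takes the place of π²/2 plus the inner sum. With `X` a free rational, the recurrence in `r`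
-- becomes an identity between rationals, applicable to every approximation of π.
closedℚ : ℕ → ℚ → ℚ
closedℚ r X = ½ * (odd⁻¹ r * binom⁻¹ r) - (+ 1 / 3) * (odd⁻¹ (suc r) * binom⁻¹ (suc r))
  - ½ * 4^- r * ((+ 1 / 4) * (+ 1 / suc r) + (+ 1 / 8) * binom r * 4^- r * X)

-- By computation this is the n-th entry of the sequence representing π²/2.
half-π² : ℕ → ℚ
half-π² n = ½ * ((+ 4 / 1) * leibniz n * ((+ 4 / 1) * leibniz n))

-- Real operations act entrywise, so the left side unfolds to a rational expression of the same
-- shape; what remains is to split the reciprocals of products, using 2^(2r+1) = 2 · 4^r.
closedForm-normal : ∀ r n → seq (closedForm r) n ≡ closedℚ r (half-π² n + sum₁ innerSummand r)
closedForm-normal r n = cong₂ _-_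
  (cong₂ _-_
    (trans (recip-* (2 ℕ.* (1 ℕ.+ 2 ℕ.* r)) (centralBinom r))
      (trans (cong (_* binom⁻¹ r) (recip-* 2 (1 ℕ.+ 2 ℕ.* r))) (*-assoc ½ (odd⁻¹ r) (binom⁻¹ r))))
    (trans (recip-* (3 ℕ.* (3 ℕ.+ 2 ℕ.* r)) (centralBinom (r ℕ.+ 1)))
      (trans (cong₂ _*_ (trans (recip-* 3 (3 ℕ.+ 2 ℕ.* r)) (cong ((+ 1 / 3) *_) (/-cong (refl {x = + 1}) (cong suc (sym (ℕ.*-suc 2 r))))))
                        (cong binom⁻¹ (ℕ.+-comm r 1)))
             (*-assoc (+ 1 / 3) (odd⁻¹ (suc r)) (binom⁻¹ (suc r))))))
  (cong₂ _*_
    (trans (/-cong (refl {x = + 1}) 2^[2r+1]) (recip-* 2 (4 ℕ.^ r)))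
    (cong₂ (λ a b → a + b * (half-π² n + sum₁ innerSummand r))
      (recip-* 4 (suc r))
      (begin
        + centralBinom r / (2 ℕ.* 4 ℕ.^ (r ℕ.+ 1))
          ≡⟨ /-ι (centralBinom r) (2 ℕ.* 4 ℕ.^ (r ℕ.+ 1)) ⟩
        binom r * (+ 1 / (2 ℕ.* 4 ℕ.^ (r ℕ.+ 1)))
          ≡⟨ cong (binom r *_) (trans (recip-* 2 (4 ℕ.^ (r ℕ.+ 1))) (cong (½ *_) (trans (cong 4^-_ (ℕ.+-comm r 1)) (4^-suc r)))) ⟩
        binom r * (½ * ((+ 1 / 4) * 4^- r))
          ≡⟨ solve 2 (λ B q → B :* (con ½ :* (con (+ 1 / 4) :* q)) := con (+ 1 / 8) :* B :* q) refl (binom r) (4^- r) ⟩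
        (+ 1 / 8) * binom r * 4^- r ∎)))
  where
  open ≡-Reasoning
  instance
    _ = centralBinom≢0 r
    _ = centralBinom≢0 (r ℕ.+ 1)
    _ = ℕ.m*n≢0 (2 ℕ.* (1 ℕ.+ 2 ℕ.* r)) (centralBinom r)
    _ = ℕ.m*n≢0 (3 ℕ.* (3 ℕ.+ 2 ℕ.* r)) (centralBinom (r ℕ.+ 1))
    _ = ℕ.m^n≢0 2 (2 ℕ.* r ℕ.+ 1)
    _ = ℕ.m^n≢0 4 r
    _ = ℕ.m^n≢0 4 (r ℕ.+ 1)
    _ = ℕ.m*n≢0 2 (4 ℕ.^ r)
    _ = ℕ.m*n≢0 2 (4 ℕ.^ (r ℕ.+ 1))
  2^[2r+1] : 2 ℕ.^ (2 ℕ.* r ℕ.+ 1) ≡ 2 ℕ.* 4 ℕ.^ r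
  2^[2r+1] = trans (cong (2 ℕ.^_) (ℕ.+-comm (2 ℕ.* r) 1)) (cong (2 ℕ.*_) (sym (ℕ.^-*-assoc 2 2 r)))

innerSummand-suc : ∀ r → innerSummand (suc r) ≡ (+ 4 / 1) * ι (4 ℕ.^ r) * (+ 1 / suc r) * (+ 1 / suc r) * binom⁻¹ (suc r)
innerSummand-suc r = begin
  innerSummand k
    ≡⟨ /-ι (4 ℕ.^ k) (k ℕ.^ 2 ℕ.* centralBinom k) ⟩
  ι (4 ℕ.^ k) * (+ 1 / (k ℕ.^ 2 ℕ.* centralBinom k))
    ≡⟨ cong₂ _*_ (ι-^ 4 r) (trans (recip-* (k ℕ.^ 2) (centralBinom k)) (cong (_* binom⁻¹ k)
         (trans (/-cong (refl {x = + 1}) (cong (k ℕ.*_) (ℕ.*-identityʳ k))) (recip-* k k)))) ⟩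
  (+ 4 / 1) * ι (4 ℕ.^ r) * ((+ 1 / k) * (+ 1 / k) * binom⁻¹ k)
    ≡⟨ solve 3 (λ p d V → p :* (d :* d :* V) := p :* d :* d :* V) refl ((+ 4 / 1) * ι (4 ℕ.^ r)) (+ 1 / k) (binom⁻¹ k) ⟩
  (+ 4 / 1) * ι (4 ℕ.^ r) * (+ 1 / k) * (+ 1 / k) * binom⁻¹ k ∎
  where
  open ≡-Reasoning
  k = suc r
  instance
    _ = ℕ.m^n≢0 k 2
    _ = centralBinom≢0 k
    _ = ℕ.m*n≢0 (k ℕ.^ 2) (centralBinom k)

-- The recurrence in r

-- Found by Gosper's algorithm.
certificate : ℕ → ℕ → ℚ
certificate r n = - ((+ 1 / suc r) * (+ 1 / suc (suc r)))
  * (binom n * binom⁻¹ (suc (n ℕ.+ r)) * odd⁻¹ (suc (n ℕ.+ r)) * ((+ 2 / 1) * ι n + ι r + (+ 2 / 1)))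

-- Here x = n, y = r, and the lower-case letters from `a` to `e` are reciprocals of linear forms.
-- The binomials of shifted index have been replaced through their recurrences, so `B * V * o` is a
-- factor of every term and a rational-function identity in n and r is left.
summand-step-algebra : ∀ x y a b o o′ d e B V →
  ((+ 2 / 1) * (x + y + 1ℚ + 1ℚ) + 1ℚ) * o′ ≡ 1ℚ → ((+ 2 / 1) * (x + 1ℚ) + 1ℚ) * b ≡ 1ℚ →
  (x + 1ℚ) * a ≡ 1ℚ → (y + 1ℚ) * d ≡ 1ℚ → (y + 1ℚ + 1ℚ) * e ≡ 1ℚ →
  (+ 8 / 1) * (y + 1ℚ) * (a * b * o′ * (B * (½ * (x + y + 1ℚ + 1ℚ) * o * V))) ≡
  ((+ 2 / 1) * y + 1ℚ) * (a * b * o * (B * V)) +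
  (- (d * e) * (((+ 2 / 1) * ((+ 2 / 1) * x + 1ℚ) * a * B) * (½ * (x + y + 1ℚ + 1ℚ) * o * V) * o′ * ((+ 2 / 1) * (x + 1ℚ) + y + (+ 2 / 1)))
   - - (d * e) * (B * V * o * ((+ 2 / 1) * x + y + (+ 2 / 1))))
summand-step-algebra x y a b o o′ d e B V ho′ hb ha hd he =
  modulo (t * (a * ((+ 2 / 1) * y + 1ℚ) * b + d * e * s))
  (modulo (t * a * o′)
  (modulo (t * d * e * s * w * o′)
  (modulo (- (t * a * o′))
  (modulo (- (t * a * o′ * ((y + 1ℚ) * d)))
  (solve 10 (λ x y a b o o′ d e B V →
     let one = con 1ℚ ; two = con (+ 2 / 1)
         t = B :* V :* o ; s = two :* x :+ y :+ two ; w = two :* (x :+ y :+ one :+ one) :+ one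
     in con (+ 8 / 1) :* (y :+ one) :* (a :* b :* o′ :* (B :* (con ½ :* (x :+ y :+ one :+ one) :* o :* V))) :=
        (two :* y :+ one) :* (a :* b :* o :* (B :* V)) :+
        (:- (d :* e) :* ((two :* (two :* x :+ one) :* a :* B) :* (con ½ :* (x :+ y :+ one :+ one) :* o :* V) :* o′ :* (two :* (x :+ one) :+ y :+ two))
         :- :- (d :* e) :* (B :* V :* o :* (two :* x :+ y :+ two)))
        :+ (t :* (a :* (two :* y :+ one) :* b :+ d :* e :* s)) :* (w :* o′ :- one)
        :+ (t :* a :* o′) :* ((two :* (x :+ one) :+ one) :* b :- one)
        :+ (t :* d :* e :* s :* w :* o′) :* ((x :+ one) :* a :- one)
        :+ (:- (t :* a :* o′)) :* ((y :+ one) :* d :- one)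
        :+ (:- (t :* a :* o′ :* ((y :+ one) :* d))) :* ((y :+ one :+ one) :* e :- one))
   refl x y a b o o′ d e B V) he) hd) ha) hb) ho′
  where
  t = B * V * o
  s = (+ 2 / 1) * x + y + (+ 2 / 1)
  w = (+ 2 / 1) * (x + y + 1ℚ + 1ℚ) + 1ℚ

ι-suc-+ : ∀ n r → ι (suc (n ℕ.+ r)) ≡ ι n + ι r + 1ℚ
ι-suc-+ n r = trans (ι-suc (n ℕ.+ r)) (cong (_+ 1ℚ) (ι-+ n r))

recip-suc-inverse : ∀ r → (ι r + 1ℚ + 1ℚ) * (+ 1 / suc (suc r)) ≡ 1ℚ
recip-suc-inverse r = trans (cong (λ t → (t + 1ℚ) * (+ 1 / suc (suc r))) (sym (ι-suc r))) (recip-inverse (suc r))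

odd⁻¹-suc-inverse : ∀ n {q} → ι n ≡ q → ((+ 2 / 1) * (q + 1ℚ) + 1ℚ) * odd⁻¹ (suc n) ≡ 1ℚ
odd⁻¹-suc-inverse n refl = trans (cong (λ t → ((+ 2 / 1) * t + 1ℚ) * odd⁻¹ (suc n)) (sym (ι-suc n))) (odd⁻¹-inverse (suc n))

binom⁻¹-step : ∀ n r → binom⁻¹ (suc (suc (n ℕ.+ r))) ≡
  ½ * (ι n + ι r + 1ℚ + 1ℚ) * odd⁻¹ (suc (n ℕ.+ r)) * binom⁻¹ (suc (n ℕ.+ r))
binom⁻¹-step n r = trans (binom⁻¹-pred (suc (n ℕ.+ r)))
  (cong (λ t → ½ * (t + 1ℚ) * odd⁻¹ (suc (n ℕ.+ r)) * binom⁻¹ (suc (n ℕ.+ r))) (ι-suc-+ n r))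

summand-step : ∀ r n →
  (+ 8 / 1) * (ι r + 1ℚ) * summandℚ (suc r) n ≡
  ((+ 2 / 1) * ι r + 1ℚ) * summandℚ r n + (certificate r (suc n) - certificate r n)
summand-step r n = begin
  (+ 8 / 1) * (y + 1ℚ) * summandℚ (suc r) n
    ≡⟨ cong (λ t → (+ 8 / 1) * (y + 1ℚ) * (a * b * odd⁻¹ (suc t) * (B * binom⁻¹ (suc t)))) (ℕ.+-suc n r) ⟩
  (+ 8 / 1) * (y + 1ℚ) * (a * b * o′ * (B * binom⁻¹ (suc m)))
    ≡⟨ cong (λ t → (+ 8 / 1) * (y + 1ℚ) * (a * b * o′ * (B * t))) (binom⁻¹-step n r) ⟩
  (+ 8 / 1) * (y + 1ℚ) * (a * b * o′ * (B * (½ * (x + y + 1ℚ + 1ℚ) * o * V)))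
    ≡⟨ summand-step-algebra x y a b o o′ d e B V
         (odd⁻¹-suc-inverse (suc (n ℕ.+ r)) (ι-suc-+ n r)) (odd⁻¹-suc-inverse n refl)
         (recip-inverse n) (recip-inverse r) (recip-suc-inverse r) ⟩
  P + (- (d * e) * (((+ 2 / 1) * ((+ 2 / 1) * x + 1ℚ) * a * B) * (½ * (x + y + 1ℚ + 1ℚ) * o * V) * o′ * ((+ 2 / 1) * (x + 1ℚ) + y + (+ 2 / 1)))
    - certificate r n)
    ≡⟨ cong₂ (λ s t → P + (- (d * e) * (s * t * o′ * ((+ 2 / 1) * (x + 1ℚ) + y + (+ 2 / 1))) - certificate r n))
         (binom-suc n) (binom⁻¹-step n r) ⟨
  P + (- (d * e) * (binom (suc n) * binom⁻¹ (suc m) * o′ * ((+ 2 / 1) * (x + 1ℚ) + y + (+ 2 / 1))) - certificate r n)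
    ≡⟨ cong (λ t → P + (- (d * e) * (binom (suc n) * binom⁻¹ (suc m) * o′ * ((+ 2 / 1) * t + y + (+ 2 / 1))) - certificate r n)) (ι-suc n) ⟨
  P + (certificate r (suc n) - certificate r n) ∎
  where
  open ≡-Reasoning
  m = suc (n ℕ.+ r)
  x = ι n
  y = ι r
  a = + 1 / suc n
  b = odd⁻¹ (suc n)
  o = odd⁻¹ m
  o′ = odd⁻¹ (suc m)
  d = + 1 / suc r
  e = + 1 / suc (suc r)
  B = binom n
  V = binom⁻¹ m
  P = ((+ 2 / 1) * y + 1ℚ) * summandℚ r n

-- `summand-step` telescopes; as `sum₁` starts at index 1, the lower boundary value is
-- `certificate r 1`.
sum-step : ∀ r N →
  (+ 8 / 1) * (ι r + 1ℚ) * sum₁ (summand (suc r)) N ≡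
  ((+ 2 / 1) * ι r + 1ℚ) * sum₁ (summand r) N + (certificate r (suc N) - certificate r 1)
sum-step r zero = solve 3 (λ p q g → p :* con 0ℚ := q :* con 0ℚ :+ (g :- g)) refl
  ((+ 8 / 1) * (ι r + 1ℚ)) ((+ 2 / 1) * ι r + 1ℚ) (certificate r 1)
sum-step r (suc N) = begin
  p * (S′ + summand (suc r) (suc N))
    ≡⟨ cong (λ t → p * (S′ + t)) (summand-normal (suc r) (suc N)) ⟩
  p * (S′ + summandℚ (suc r) (suc N))
    ≡⟨ *-distribˡ-+ p S′ (summandℚ (suc r) (suc N)) ⟩
  p * S′ + p * summandℚ (suc r) (suc N)
    ≡⟨ cong₂ _+_ (sum-step r N) (summand-step r (suc N)) ⟩
  (q * S + (G (suc N) - G 1)) + (q * summandℚ r (suc N) + (G (suc (suc N)) - G (suc N)))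
    ≡⟨ solve 6 (λ q S g g₁ s g′ → (q :* S :+ (g :- g₁)) :+ (q :* s :+ (g′ :- g)) := q :* (S :+ s) :+ (g′ :- g₁)) refl
         q S (G (suc N)) (G 1) (summandℚ r (suc N)) (G (suc (suc N))) ⟩
  q * (S + summandℚ r (suc N)) + (G (suc (suc N)) - G 1)
    ≡⟨ cong (λ t → q * (S + t) + (G (suc (suc N)) - G 1)) (summand-normal r (suc N)) ⟨
  q * (S + summand r (suc N)) + (G (suc (suc N)) - G 1) ∎
  where
  open ≡-Reasoning
  p = (+ 8 / 1) * (ι r + 1ℚ)
  q = (+ 2 / 1) * ι r + 1ℚ
  S = sum₁ (summand r) N
  S′ = sum₁ (summand (suc r)) N
  G = certificate r

-- The limit in n of `certificate r n`: the binomial ratio tends to 4^(-(r+1)) and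
-- (2n+r+2)/(2n+2r+3) tends to 1.
certificate∞ : ℕ → ℚ
certificate∞ r = - ((+ 1 / suc r) * (+ 1 / suc (suc r))) * 4^- suc r

-- The two terms of the closed form without π account for the lower boundary value. All reciprocal
-- binomials are written over V = 1/binom(2r+4, r+2); the subtracted last line is `certificate r 1`,
-- with the 2 before `V` coming from binom(2,1).
closed-binomial-algebra : ∀ y o₂ d e V →
  ((+ 2 / 1) * (y + 1ℚ + 1ℚ) + 1ℚ) * o₂ ≡ 1ℚ → (y + 1ℚ) * d ≡ 1ℚ → (y + 1ℚ + 1ℚ) * e ≡ 1ℚ →
  (+ 8 / 1) * (y + 1ℚ) * (½ * ((+ 2 / 1) * e * V) - (+ 1 / 3) * (o₂ * V)) ≡
  ((+ 2 / 1) * y + 1ℚ) * (½ * ((+ 2 / 1) * d * ((+ 2 / 1) * ((+ 2 / 1) * (y + 1ℚ) + 1ℚ) * e * V)) - (+ 1 / 3) * ((+ 2 / 1) * e * V))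
  - - (d * e) * ((+ 2 / 1) * V * o₂ * ((+ 2 / 1) * 1ℚ + y + (+ 2 / 1)))
closed-binomial-algebra y o₂ d e V ho hd he =
  modulo (V * (- (α * e * d * D) - δ * d * e))
  (modulo (V * (- (α * e) - γ * o₂))
  (modulo (V * (- (γ * o₂ * d * D)))
  (solve 5 (λ y o₂ d e V →
     let one = con 1ℚ ; two = con (+ 2 / 1) ; D = y :+ one
         α = con (+ 8 / 1) :* D :+ con (+ 2 / 3) :* (two :* y :+ one)
         γ = :- (con (+ 8 / 3) :* D)
         δ = :- (two :* (two :* y :+ one) :* (two :* y :+ con (+ 3 / 1)))
     in con (+ 8 / 1) :* (y :+ one) :* (con ½ :* (two :* e :* V) :- con (+ 1 / 3) :* (o₂ :* V)) :=
        (two :* y :+ one) :* (con ½ :* (two :* d :* (two :* (two :* (y :+ one) :+ one) :* e :* V)) :- con (+ 1 / 3) :* (two :* e :* V))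
        :- :- (d :* e) :* (two :* V :* o₂ :* (two :* one :+ y :+ two))
        :+ (V :* (:- (α :* e :* d :* D) :- δ :* d :* e)) :* ((two :* (y :+ one :+ one) :+ one) :* o₂ :- one)
        :+ (V :* (:- (α :* e) :- γ :* o₂)) :* ((y :+ one) :* d :- one)
        :+ (V :* (:- (γ :* o₂ :* d :* D))) :* ((y :+ one :+ one) :* e :- one))
   refl y o₂ d e V) he) hd) ho
  where
  D = y + 1ℚ
  -- After division by `V`, `α`, `γ` and `δ` are the coefficients of `e`, `o₂` and `d * e` in the
  -- left side minus the right side.
  α = (+ 8 / 1) * D + (+ 2 / 3) * ((+ 2 / 1) * y + 1ℚ)
  γ = - ((+ 8 / 3) * D)
  δ = - ((+ 2 / 1) * ((+ 2 / 1) * y + 1ℚ) * ((+ 2 / 1) * y + (+ 3 / 1)))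

-- The remaining part of the closed form accounts for the limit of the certificate; here p = 4^r and
-- q = 4^(-r). The new inner summand is stripped of its power and its binomial by p q = 1 and B₁ V₁
-- = 1, while the recurrence for `B₁` makes the coefficients of `X` agree.
closed-π-algebra : ∀ y d e p q B B₁ V₁ X →
  (y + 1ℚ) * d ≡ 1ℚ → (y + 1ℚ + 1ℚ) * e ≡ 1ℚ → p * q ≡ 1ℚ → B₁ * V₁ ≡ 1ℚ →
  B₁ ≡ (+ 2 / 1) * ((+ 2 / 1) * y + 1ℚ) * d * B →
  (+ 8 / 1) * (y + 1ℚ) * (½ * ((+ 1 / 4) * q) *
    ((+ 1 / 4) * e + (+ 1 / 8) * B₁ * ((+ 1 / 4) * q) * (X + (+ 4 / 1) * p * d * d * V₁))) ≡
  ((+ 2 / 1) * y + 1ℚ) * (½ * q * ((+ 1 / 4) * d + (+ 1 / 8) * B * q * X))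
  - - (d * e) * ((+ 1 / 4) * q)
closed-π-algebra y d e p q B B₁ V₁ X hd he hpq hBV hB = begin
  (+ 8 / 1) * (y + 1ℚ) * (½ * ((+ 1 / 4) * q) *
    ((+ 1 / 4) * e + (+ 1 / 8) * B₁ * ((+ 1 / 4) * q) * (X + (+ 4 / 1) * p * d * d * V₁)))
    ≡⟨ modulo ((+ 1 / 8) * (y + 1ℚ) * d * d * q)
       (modulo ((+ 1 / 8) * (y + 1ℚ) * d * d * q * (p * q))
       (solve 8 (λ y d e p q B₁ V₁ X → let one = con 1ℚ in
          con (+ 8 / 1) :* (y :+ one) :* (con ½ :* (con (+ 1 / 4) :* q) :*
            (con (+ 1 / 4) :* e :+ con (+ 1 / 8) :* B₁ :* (con (+ 1 / 4) :* q) :* (X :+ con (+ 4 / 1) :* p :* d :* d :* V₁))) :=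
          con (+ 1 / 4) :* (y :+ one) :* q :* e :+ con (+ 1 / 32) :* (y :+ one) :* q :* q :* X :* B₁ :+ con (+ 1 / 8) :* (y :+ one) :* d :* d :* q
          :+ con (+ 1 / 8) :* (y :+ one) :* d :* d :* q :* (p :* q :- one)
          :+ con (+ 1 / 8) :* (y :+ one) :* d :* d :* q :* (p :* q) :* (B₁ :* V₁ :- one))
        refl y d e p q B₁ V₁ X) hBV) hpq ⟩
  (+ 1 / 4) * (y + 1ℚ) * q * e + (+ 1 / 32) * (y + 1ℚ) * q * q * X * B₁ + (+ 1 / 8) * (y + 1ℚ) * d * d * q
    ≡⟨ cong (λ t → (+ 1 / 4) * (y + 1ℚ) * q * e + (+ 1 / 32) * (y + 1ℚ) * q * q * X * t + (+ 1 / 8) * (y + 1ℚ) * d * d * q) hB ⟩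
  (+ 1 / 4) * (y + 1ℚ) * q * e + (+ 1 / 32) * (y + 1ℚ) * q * q * X * ((+ 2 / 1) * ((+ 2 / 1) * y + 1ℚ) * d * B) + (+ 1 / 8) * (y + 1ℚ) * d * d * q
    ≡⟨ modulo ((+ 1 / 16) * ((+ 2 / 1) * y + 1ℚ) * q * q * X * B + (+ 1 / 8) * d * q - (+ 1 / 4) * q * (y + 1ℚ) * e)
       (modulo ((+ 1 / 4) * q * y * d)
       (solve 6 (λ y d e q B X → let one = con 1ℚ ; two = con (+ 2 / 1) in
          con (+ 1 / 4) :* (y :+ one) :* q :* e :+ con (+ 1 / 32) :* (y :+ one) :* q :* q :* X :* (two :* (two :* y :+ one) :* d :* B) :+ con (+ 1 / 8) :* (y :+ one) :* d :* d :* q :=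
          (two :* y :+ one) :* (con ½ :* q :* (con (+ 1 / 4) :* d :+ con (+ 1 / 8) :* B :* q :* X))
          :- :- (d :* e) :* (con (+ 1 / 4) :* q)
          :+ (con (+ 1 / 16) :* (two :* y :+ one) :* q :* q :* X :* B :+ con (+ 1 / 8) :* d :* q :- con (+ 1 / 4) :* q :* (y :+ one) :* e) :* ((y :+ one) :* d :- one)
          :+ (con (+ 1 / 4) :* q :* y :* d) :* ((y :+ one :+ one) :* e :- one))
        refl y d e q B X) he) hd ⟩
  ((+ 2 / 1) * y + 1ℚ) * (½ * q * ((+ 1 / 4) * d + (+ 1 / 8) * B * q * X)) - - (d * e) * ((+ 1 / 4) * q) ∎
  where open ≡-Reasoning

-- This is the recurrence of `sum-step` with N sent to infinity. The terms without π supply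
-- `certificate r 1` and the bracket containing `X` supplies `certificate∞ r`.
closed-step : ∀ r X →
  (+ 8 / 1) * (ι r + 1ℚ) * closedℚ (suc r) (X + innerSummand (suc r)) ≡
  ((+ 2 / 1) * ι r + 1ℚ) * closedℚ r X + (certificate∞ r - certificate r 1)
closed-step r X = begin
  k * (½ * (odd⁻¹ (suc r) * V₁) - (+ 1 / 3) * (o₂ * V₂)
       - ½ * 4^- suc r * ((+ 1 / 4) * e + (+ 1 / 8) * B₁ * 4^- suc r * (X + innerSummand (suc r))))
    ≡⟨ solve 3 (λ k a b → k :* (a :- b) := k :* a :- k :* b) refl k
         (½ * (odd⁻¹ (suc r) * V₁) - (+ 1 / 3) * (o₂ * V₂))
         (½ * 4^- suc r * ((+ 1 / 4) * e + (+ 1 / 8) * B₁ * 4^- suc r * (X + innerSummand (suc r)))) ⟩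
  k * (½ * (odd⁻¹ (suc r) * V₁) - (+ 1 / 3) * (o₂ * V₂))
  - k * (½ * 4^- suc r * ((+ 1 / 4) * e + (+ 1 / 8) * B₁ * 4^- suc r * (X + innerSummand (suc r))))
    ≡⟨ cong₂ _-_ binomialPart πPart ⟩
  (l * (½ * (odd⁻¹ r * V) - (+ 1 / 3) * (odd⁻¹ (suc r) * V₁)) - certificate r 1)
  - (l * (½ * q * ((+ 1 / 4) * d + (+ 1 / 8) * B * q * X)) - certificate∞ r)
    ≡⟨ solve 5 (λ l a g b h → (l :* a :- g) :- (l :* b :- h) := l :* (a :- b) :+ (h :- g)) refl l
         (½ * (odd⁻¹ r * V) - (+ 1 / 3) * (odd⁻¹ (suc r) * V₁)) (certificate r 1)
         (½ * q * ((+ 1 / 4) * d + (+ 1 / 8) * B * q * X)) (certificate∞ r) ⟩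
  l * closedℚ r X + (certificate∞ r - certificate r 1) ∎
  where
  open ≡-Reasoning
  y = ι r
  k = (+ 8 / 1) * (y + 1ℚ)
  l = (+ 2 / 1) * y + 1ℚ
  d = + 1 / suc r
  e = + 1 / suc (suc r)
  o₂ = odd⁻¹ (suc (suc r))
  V = binom⁻¹ r
  V₁ = binom⁻¹ (suc r)
  V₂ = binom⁻¹ (suc (suc r))
  B = binom r
  B₁ = binom (suc r)
  q = 4^- r
  o₁V₁ : odd⁻¹ (suc r) * V₁ ≡ (+ 2 / 1) * e * V₂
  o₁V₁ = odd⁻¹*binom⁻¹ (suc r)
  oV : odd⁻¹ r * V ≡ (+ 2 / 1) * d * ((+ 2 / 1) * ((+ 2 / 1) * (y + 1ℚ) + 1ℚ) * e * V₂)
  oV = trans (odd⁻¹*binom⁻¹ r) (cong ((+ 2 / 1) * d *_)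
    (trans (binom⁻¹-suc (suc r)) (cong (λ t → (+ 2 / 1) * ((+ 2 / 1) * t + 1ℚ) * e * V₂) (ι-suc r))))
  binomialPart : k * (½ * (odd⁻¹ (suc r) * V₁) - (+ 1 / 3) * (o₂ * V₂)) ≡
                 l * (½ * (odd⁻¹ r * V) - (+ 1 / 3) * (odd⁻¹ (suc r) * V₁)) - certificate r 1
  binomialPart = begin
    k * (½ * (odd⁻¹ (suc r) * V₁) - (+ 1 / 3) * (o₂ * V₂))
      ≡⟨ cong (λ t → k * (½ * t - (+ 1 / 3) * (o₂ * V₂))) o₁V₁ ⟩
    k * (½ * ((+ 2 / 1) * e * V₂) - (+ 1 / 3) * (o₂ * V₂))
      ≡⟨ closed-binomial-algebra y o₂ d e V₂ (odd⁻¹-suc-inverse (suc r) (ι-suc r)) (recip-inverse r) (recip-suc-inverse r) ⟩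
    l * (½ * ((+ 2 / 1) * d * ((+ 2 / 1) * ((+ 2 / 1) * (y + 1ℚ) + 1ℚ) * e * V₂)) - (+ 1 / 3) * ((+ 2 / 1) * e * V₂)) - certificate r 1
      ≡⟨ cong₂ (λ s t → l * (½ * s - (+ 1 / 3) * t) - certificate r 1) oV o₁V₁ ⟨
    l * (½ * (odd⁻¹ r * V) - (+ 1 / 3) * (odd⁻¹ (suc r) * V₁)) - certificate r 1 ∎
  πPart : k * (½ * 4^- suc r * ((+ 1 / 4) * e + (+ 1 / 8) * B₁ * 4^- suc r * (X + innerSummand (suc r)))) ≡
          l * (½ * q * ((+ 1 / 4) * d + (+ 1 / 8) * B * q * X)) - certificate∞ r
  πPart = begin
    k * (½ * 4^- suc r * ((+ 1 / 4) * e + (+ 1 / 8) * B₁ * 4^- suc r * (X + innerSummand (suc r))))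
      ≡⟨ cong₂ (λ s t → k * (½ * s * ((+ 1 / 4) * e + (+ 1 / 8) * B₁ * s * (X + t)))) (4^-suc r) (innerSummand-suc r) ⟩
    k * (½ * ((+ 1 / 4) * q) * ((+ 1 / 4) * e + (+ 1 / 8) * B₁ * ((+ 1 / 4) * q) * (X + (+ 4 / 1) * ι (4 ℕ.^ r) * d * d * V₁)))
      ≡⟨ closed-π-algebra y d e (ι (4 ℕ.^ r)) q B B₁ V₁ X (recip-inverse r) (recip-suc-inverse r)
           (4^-inverse r) (binom-inverse (suc r)) (binom-suc r) ⟩
    l * (½ * q * ((+ 1 / 4) * d + (+ 1 / 8) * B * q * X)) - - (d * e) * ((+ 1 / 4) * q)
      ≡⟨ cong (λ t → l * (½ * q * ((+ 1 / 4) * d + (+ 1 / 8) * B * q * X)) - - (d * e) * t) (4^-suc r) ⟨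
    l * (½ * q * ((+ 1 / 4) * d + (+ 1 / 8) * B * q * X)) - certificate∞ r ∎

-- Limits of the binomial ratio and of the certificate

null-0 : Null (λ _ → 0ℚ)
null-0 ε ε>0 = 0 , λ _ _ → <⇒≤ ε>0

ratioError : ℕ → ℕ → ℚ
ratioError k n = ι (4 ℕ.^ k) * (binom n * binom⁻¹ (n ℕ.+ k)) - 1ℚ

-- Raising k multiplies the scaled ratio by 4(z+1)/(2(2z+1)) = 1 + 1/(2z+1) with z = n + k, and (1 +
-- err)(1 + o) - 1 = err + (o + err o).
ratioError-suc : ∀ k n →
  ratioError k n + (odd⁻¹ (n ℕ.+ k) + ratioError k n * odd⁻¹ (n ℕ.+ k)) ≡ ratioError (suc k) n
ratioError-suc k n = sym (begin
  ι (4 ℕ.^ suc k) * (B * binom⁻¹ (n ℕ.+ suc k)) - 1ℚ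
    ≡⟨ cong₂ (λ s t → s * (B * t) - 1ℚ) (ι-^ 4 k) (trans (cong binom⁻¹ (ℕ.+-suc n k)) (binom⁻¹-pred (n ℕ.+ k))) ⟩
  (+ 4 / 1) * p * (B * (½ * (z + 1ℚ) * o * V)) - 1ℚ
    ≡⟨ modulo (p * (B * V)) (solve 5 (λ p B V z o → let one = con 1ℚ in
         con (+ 4 / 1) :* p :* (B :* (con ½ :* (z :+ one) :* o :* V)) :- one :=
         (p :* (B :* V) :- one) :+ (o :+ (p :* (B :* V) :- one) :* o)
         :+ p :* (B :* V) :* ((con (+ 2 / 1) :* z :+ one) :* o :- one)) refl p B V z o) (odd⁻¹-inverse (n ℕ.+ k)) ⟩
  ratioError k n + (o + ratioError k n * o) ∎)
  where
  open ≡-Reasoning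
  p = ι (4 ℕ.^ k)
  B = binom n
  V = binom⁻¹ (n ℕ.+ k)
  z = ι (n ℕ.+ k)
  o = odd⁻¹ (n ℕ.+ k)

null-ratioError : ∀ k → Null (ratioError k)
null-ratioError zero    = null-cong (λ n → sym (begin
  1ℚ * (binom n * binom⁻¹ (n ℕ.+ 0)) - 1ℚ    ≡⟨ cong (_- 1ℚ) (*-identityˡ (binom n * binom⁻¹ (n ℕ.+ 0))) ⟩
  binom n * binom⁻¹ (n ℕ.+ 0) - 1ℚ           ≡⟨ cong (λ t → binom n * binom⁻¹ t - 1ℚ) (ℕ.+-identityʳ n) ⟩
  binom n * binom⁻¹ n - 1ℚ                   ≡⟨ cong (_- 1ℚ) (binom-inverse n) ⟩
  0ℚ                                         ∎)) null-0
  where open ≡-Reasoning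
null-ratioError (suc k) = null-cong (ratioError-suc k)
  (null-+ (null-ratioError k) (null-+ no (null-* (null-ratioError k) no)))
  where
  no : Null (λ n → odd⁻¹ (n ℕ.+ k))
  no = null-shift k null-odd⁻¹

-- With o = 1/(2n+2r+3) one has (2n+r+2) o = 1 - (r+1) o. The certificate is thus its limit times (1
-- + err)(1 - (r+1) o), where err is `ratioError (suc r) n`.
certificate-limit : ∀ r → Null (λ n → certificate r n - certificate∞ r)
certificate-limit r = null-cong expand
  (null-scale (c * 4^- suc r) (null-+ (null-ratioError (suc r))
    (null-scale (- (ι r + 1ℚ)) (null-+ no (null-* (null-ratioError (suc r)) no)))))
  where
  open ≡-Reasoning
  c = - ((+ 1 / suc r) * (+ 1 / suc (suc r)))
  no : Null (λ n → odd⁻¹ (n ℕ.+ suc r))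
  no = null-shift (suc r) null-odd⁻¹
  expand : ∀ n → c * 4^- suc r * (ratioError (suc r) n + - (ι r + 1ℚ) * (odd⁻¹ (n ℕ.+ suc r) + ratioError (suc r) n * odd⁻¹ (n ℕ.+ suc r)))
               ≡ certificate r n - certificate∞ r
  expand n = sym (begin
    c * (B * V m * odd⁻¹ m * s) - c * q
      ≡⟨ cong (λ t → c * (B * V t * odd⁻¹ t * s) - c * q) (ℕ.+-suc n r) ⟨
    c * (B * V m′ * odd⁻¹ m′ * s) - c * q
      ≡⟨ modulo (c * B * V m′) (modulo (- (c * B * V m′ * (1ℚ - (y + 1ℚ) * odd⁻¹ m′)))
           (solve 8 (λ c p q B V o x y → let one = con 1ℚ ; two = con (+ 2 / 1) ; err = p :* (B :* V) :- one in
              c :* (B :* V :* o :* (two :* x :+ y :+ two)) :- c :* q :=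
              c :* q :* (err :+ :- (y :+ one) :* (o :+ err :* o))
              :+ c :* B :* V :* ((two :* (x :+ y :+ one) :+ one) :* o :- one)
              :+ (:- (c :* B :* V :* (one :- (y :+ one) :* o))) :* (p :* q :- one))
            refl c p q B (V m′) (odd⁻¹ m′) x y) (4^-inverse (suc r)))
           (trans (cong (λ t → ((+ 2 / 1) * t + 1ℚ) * odd⁻¹ m′) (sym (ι-+-suc n r))) (odd⁻¹-inverse m′)) ⟩
    c * q * (ratioError (suc r) n + - (y + 1ℚ) * (odd⁻¹ m′ + ratioError (suc r) n * odd⁻¹ m′)) ∎)
    where
    m = suc (n ℕ.+ r)
    m′ = n ℕ.+ suc r
    x = ι n
    y = ι r
    s = (+ 2 / 1) * x + y + (+ 2 / 1)
    B = binom n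
    V = binom⁻¹
    q = 4^- suc r
    p = ι (4 ℕ.^ suc r)

-- The case r = 0

summandℚ-zero : ∀ n → summandℚ 0 n ≡ ½ * odd⁻¹ n * (odd⁻¹ (suc n) * odd⁻¹ (suc n))
summandℚ-zero n = begin
  summandℚ 0 n
    ≡⟨ cong (λ t → a * w * odd⁻¹ (suc t) * (B * binom⁻¹ (suc t))) (ℕ.+-identityʳ n) ⟩
  a * w * w * (B * binom⁻¹ (suc n))
    ≡⟨ cong (λ t → a * w * w * (B * t)) (binom⁻¹-pred n) ⟩
  a * w * w * (B * (½ * (ι n + 1ℚ) * u * V))
    ≡⟨ modulo (½ * u * w * w) (modulo (½ * u * w * w * ((ι n + 1ℚ) * a))
         (solve 6 (λ x a u w B V → let one = con 1ℚ in
            a :* w :* w :* (B :* (con ½ :* (x :+ one) :* u :* V)) :=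
            con ½ :* u :* (w :* w)
            :+ con ½ :* u :* w :* w :* ((x :+ one) :* a :- one)
            :+ con ½ :* u :* w :* w :* ((x :+ one) :* a) :* (B :* V :- one)) refl (ι n) a u w B V)
         (binom-inverse n)) (recip-inverse n) ⟩
  ½ * u * (w * w) ∎
  where
  open ≡-Reasoning
  a = + 1 / suc n
  u = odd⁻¹ n
  w = odd⁻¹ (suc n)
  B = binom n
  V = binom⁻¹ n

-- For u = 1/(2n+1) and w = 1/(2n+3) one has u - w = 2uw, so the summand uw²/2 equals (u - w)/8 -
-- w²/4: a telescoping part and an odd square. As n starts at 1, the constant is 1/24 + 10/36 =
-- 23/72, where 10/9 is `oddSquares 2`.
sum-zero : ∀ N → sum₁ (summand 0) N ≡
  + 23 / 72 - (+ 1 / 4) * oddSquares (suc (suc N)) - (+ 1 / 8) * odd⁻¹ (suc N)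
sum-zero zero    = refl
sum-zero (suc N) = begin
  sum₁ (summand 0) N + summand 0 (suc N)
    ≡⟨ cong₂ _+_ (sum-zero N) (trans (summand-normal 0 (suc N)) (summandℚ-zero (suc N))) ⟩
  + 23 / 72 - (+ 1 / 4) * Q - (+ 1 / 8) * u + ½ * u * (w * w)
    ≡⟨ modulo ((+ 1 / 8) * u + (+ 1 / 4) * u * w) (modulo (- ((+ 1 / 8) * w) - (+ 1 / 4) * w * w)
         (solve 4 (λ x Q u w → let one = con 1ℚ ; two = con (+ 2 / 1) in
            con (+ 23 / 72) :- con (+ 1 / 4) :* Q :- con (+ 1 / 8) :* u :+ con ½ :* u :* (w :* w) :=
            con (+ 23 / 72) :- con (+ 1 / 4) :* (Q :+ w :* w) :- con (+ 1 / 8) :* w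
            :+ (con (+ 1 / 8) :* u :+ con (+ 1 / 4) :* u :* w) :* ((two :* (x :+ one) :+ one) :* w :- one)
            :+ (:- (con (+ 1 / 8) :* w) :- con (+ 1 / 4) :* w :* w) :* ((two :* x :+ one) :* u :- one)) refl (ι (suc N)) Q u w)
         (odd⁻¹-inverse (suc N))) (odd⁻¹-suc-inverse (suc N) refl) ⟩
  + 23 / 72 - (+ 1 / 4) * (Q + w * w) - (+ 1 / 8) * w ∎
  where
  open ≡-Reasoning
  Q = oddSquares (suc (suc N))
  u = odd⁻¹ (suc N)
  w = odd⁻¹ (suc (suc N))

-- The same index truncates the series and the approximation of π, as `hasSum₁-null` requires.
error : ℕ → ℕ → ℚ
error r N = sum₁ (summand r) N - closedℚ r (half-π² N + sum₁ innerSummand r)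

-- At r = 0 the closed form is 23/72 - X/16 with X = 8L², so the constants cancel and L²/2 - Q/4 is
-- a quarter of the kernel sum. The remaining terms come from `oddSquares` running two indices
-- further and from the telescoped end.
error-zero : ∀ N → (+ 1 / 4) * kernelSum N
  + (- (+ 1 / 4) * (odd⁻¹ N * odd⁻¹ N + odd⁻¹ (suc N) * odd⁻¹ (suc N)) + - (+ 1 / 8) * odd⁻¹ (suc N)) ≡ error 0 N
error-zero N = begin
  (+ 1 / 4) * kernelSum N + (- (+ 1 / 4) * (u * u + w * w) + - (+ 1 / 8) * w)
    ≡⟨ cong (λ t → (+ 1 / 4) * t + (- (+ 1 / 4) * (u * u + w * w) + - (+ 1 / 8) * w)) (leibniz²-oddSquares N) ⟨
  (+ 1 / 4) * ((+ 2 / 1) * (L * L) - Q) + (- (+ 1 / 4) * (u * u + w * w) + - (+ 1 / 8) * w)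
    ≡⟨ solve 4 (λ L Q u w →
         con (+ 1 / 4) :* (con (+ 2 / 1) :* (L :* L) :- Q) :+ (:- con (+ 1 / 4) :* (u :* u :+ w :* w) :+ :- con (+ 1 / 8) :* w) :=
         (con (+ 23 / 72) :- con (+ 1 / 4) :* (Q :+ u :* u :+ w :* w) :- con (+ 1 / 8) :* w)
         -- These literals are the values of the factors of `closedℚ 0`; 1/6 is
         -- `odd⁻¹ 1 * binom⁻¹ 1`.
         :- (con ½ :* con 1ℚ :- con (+ 1 / 3) :* con (+ 1 / 6)
             :- con ½ :* con 1ℚ :* (con (+ 1 / 4) :* con 1ℚ :+ con (+ 1 / 8) :* con 1ℚ :* con 1ℚ :*
                 (con ½ :* (con (+ 4 / 1) :* L :* (con (+ 4 / 1) :* L)) :+ con 0ℚ)))) refl L Q u w ⟩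
  (+ 23 / 72 - (+ 1 / 4) * oddSquares (suc (suc N)) - (+ 1 / 8) * w) - closedℚ 0 (half-π² N + sum₁ innerSummand 0)
    ≡⟨ cong (_- closedℚ 0 (half-π² N + sum₁ innerSummand 0)) (sum-zero N) ⟨
  error 0 N ∎
  where
  open ≡-Reasoning
  L = leibniz N
  Q = oddSquares N
  u = odd⁻¹ N
  w = odd⁻¹ (suc N)

-- Induction on r

null-suc : ∀ {x} → Null x → Null (λ n → x (suc n))
null-suc {x} nx = null-cong (λ n → cong x (ℕ.+-comm n 1)) (null-shift 1 nx)

-- Subtracting `closed-step` from `sum-step` cancels `certificate r 1`, leaving the previous error
-- and the distance of the certificate from its limit; then 8(r+1) is divided out.
error-suc : ∀ r N → (+ 1 / 8) * (+ 1 / suc r) *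
  (((+ 2 / 1) * ι r + 1ℚ) * error r N + (certificate r (suc N) - certificate∞ r)) ≡ error (suc r) N
error-suc r N = sym (modulo (- (S′ - C′)) (begin
  S′ - C′
    ≡⟨ solve 4 (λ y d S C → S :- C :=
         con (+ 1 / 8) :* d :* (con (+ 8 / 1) :* (y :+ con 1ℚ) :* S :- con (+ 8 / 1) :* (y :+ con 1ℚ) :* C)
         :+ (:- (S :- C)) :* ((y :+ con 1ℚ) :* d :- con 1ℚ)) refl y d S′ C′ ⟩
  (+ 1 / 8) * d * (k * S′ - k * C′) + - (S′ - C′) * ((y + 1ℚ) * d - 1ℚ)
    ≡⟨ cong₂ (λ s t → (+ 1 / 8) * d * (s - t) + - (S′ - C′) * ((y + 1ℚ) * d - 1ℚ)) (sum-step r N) rec ⟩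
  (+ 1 / 8) * d * ((l * S + (G (suc N) - G 1)) - (l * C + (certificate∞ r - G 1))) + - (S′ - C′) * ((y + 1ℚ) * d - 1ℚ)
    ≡⟨ cong (λ t → (+ 1 / 8) * d * t + - (S′ - C′) * ((y + 1ℚ) * d - 1ℚ))
         (solve 6 (λ l S C g g₁ h → (l :* S :+ (g :- g₁)) :- (l :* C :+ (h :- g₁)) := l :* (S :- C) :+ (g :- h)) refl
            l S C (G (suc N)) (G 1) (certificate∞ r)) ⟩
  (+ 1 / 8) * d * (l * (S - C) + (G (suc N) - certificate∞ r)) + - (S′ - C′) * ((y + 1ℚ) * d - 1ℚ) ∎)
  (recip-inverse r))
  where
  open ≡-Reasoning
  y = ι r
  d = + 1 / suc r
  k = (+ 8 / 1) * (y + 1ℚ)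
  l = (+ 2 / 1) * y + 1ℚ
  G = certificate r
  I = sum₁ innerSummand r
  S = sum₁ (summand r) N
  S′ = sum₁ (summand (suc r)) N
  C = closedℚ r (half-π² N + I)
  C′ = closedℚ (suc r) (half-π² N + sum₁ innerSummand (suc r))
  rec : k * C′ ≡ l * C + (certificate∞ r - G 1)
  rec = trans (cong (λ t → k * closedℚ (suc r) t) (sym (+-assoc (half-π² N) I (innerSummand (suc r)))))
    (closed-step r (half-π² N + I))

null-error : ∀ r → Null (error r)
null-error zero    = null-cong error-zero
  (null-+ (null-scale (+ 1 / 4) null-kernelSum)
    (null-+ (null-scale (- (+ 1 / 4)) (null-+ (null-* null-odd⁻¹ null-odd⁻¹) (null-* no no)))
            (null-scale (- (+ 1 / 8)) no)))
  where
  no : Null (λ n → odd⁻¹ (suc n))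
  no = null-suc null-odd⁻¹
null-error (suc r) = null-cong (error-suc r)
  (null-scale ((+ 1 / 8) * (+ 1 / suc r))
    (null-+ (null-scale ((+ 2 / 1) * ι r + 1ℚ) (null-error r)) (null-suc (certificate-limit r))))

theorem5p0p5 : (r : ℕ) → HasSum₁ (summand r) (closedForm r)
theorem5p0p5 r = hasSum₁-null (closedForm r)
  (null-cong (λ n → cong (λ t → sum₁ (summand r) n - t) (sym (closedForm-normal r n))) (null-error r))
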